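{- Let $q>3$ be a prime power. (a) The ideal $$\mathcal{I}_q:=\langle F_{a,b}\colon a,b\in\mathbb{F}_q,\ a\neq b\rangle+\langle x_i^q-x_i\colon i\in\{0,\ldots,q-2\}\rangle\subset\mathbb{F}_q[X_q]$$ is zero-dimensional and radical, and $\mathcal{P}_q$ is identified with its algebraic set $\mathcal{Z}(\mathcal{I}_q)$, via the bijection $(s_0,\ldots,s_{q-2})\mapsto\sum_{i=0}^{q-2}s_ix^i$ from $\mathcal{Z}(\mathcal{I}_q)$ onto $\mathcal{P}_q$. As a consequence, $|\mathcal{P}_q|=|\mathcal{Z}(\mathcal{I}_q)|=\dim_{\mathbb{F}_q}(\mathbb{F}_q[X_q]/\mathcal{I}_q)$. (b) The ideal $$\mathcal{J}_q:=\langle G^{\mathrm{row}}_{a,b,c},\,G^{\mathrm{col}}_{a,b,c}\colon a,b,c\in\mathbb{F}_q,\ a\neq b\rangle+\langle x_{ij}^q-x_{ij}\colon i,j\in\{0,\ldots,q-2\}\rangle\subset\mathbb{F}_q[\overline{X}_q]$$ is zero-dimensional and radical, and $\mathcal{LP}_q$ is identified with its algebraic set $\mathcal{Z}(\mathcal{J}_q)$, via the bijection $(s_{ij})_{0\le i,j\le q-2}\mapsto\sum_{i,j=0}^{q-2}s_{ij}x^iy^j$ from $\mathcal{Z}(\mathcal{J}_q)$ onto $\mathcal{LP}_q$. As a consequence, $|\mathcal{LP}_q|=|\mathcal{Z}(\mathcal{J}_q)|=\dim_{\mathbb{F}_q}(\mathbb{F}_q[\overline{X}_q]/\mathcal{J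}_q)$.
   Context: $\mathbb{F}_q$ is the finite field with $q$ elements. $\mathcal{P}_q$ is the set of permutation polynomials: polynomials in $\mathbb{F}_q[x]$ of degree less than $q$ that act as permutations of $\mathbb{F}_q$. $\mathcal{LP}_q$ is the set of local permutation polynomials: polynomials $f\in\mathbb{F}_q[x,y]$ of degree less than $q$ in each variable such that, for every $a\in\mathbb{F}_q$, both $f(x,a)$ and $f(a,x)$ act as permutations of $\mathbb{F}_q$. $X_q:=\{x_i\colon 0\le i\le q-2\}$ and $\overline{X}_q:=\{x_{ij}\colon 0\le i,j\le q-2\}$ are sets of variables. Put $F(x):=x^{q-1}-1$ and, for $a,b,c\in\mathbb{F}_q$ with $a\ne b$ (with the convention $0^0=1$), $$F_{a,b}:=F\Big(\sum_{i=0}^{q-2}(a^i-b^i)x_i\Big)\in\mathbb{F}_q[X_q],$$ $$G^{\mathrm{row}}_{a,b,c}:=F\Big(\sum_{i,j=0}^{q-2}(a^i-b^i)c^jx_{ji}\Big),\qquad G^{\mathrm{col}}_{a,b,c}:=F\Big(\sum_{i,j=0}^{q-2}(a^i-b^i)c^jx_{ij}\Big)\in\mathbb{F}_q[\overline{X}_q].$$ For an ideal $I$ of a polynomial ring over $\mathbb{F}_q$ in $n$ variables, $\mathcal{Z}(I)$ denotes the set of points of $\mathbb{F}_q^n$ at which all elements of $I$ vanish; $I$ is zero-dimensional if the quotient ring by $I$ is a finite-dimensional $\mathbb{F}_q$-vector space. -}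

module Defs where

open import Algebra.Bundles using (CommutativeRing; RawRing; RawMonoid)
open import Algebra.Module.Bundles.Raw using (RawLeftModule)
import Algebra.Definitions.RawMonoid as MonoidOps
import Algebra.Definitions.RawSemiring as SemiringOps
open import Data.Bool.Base using (if_then_else_)
open import Data.Fin.Base using (Fin; zero; suc; toℕ; combine)
open import Data.List.Base as List using (List; []; _∷_; _++_)
open import Data.Nat.Base as ℕ using (ℕ; _∸_; _<_)
import Data.Nat.Properties as ℕ
open import Data.Nat.Primality using (Prime)
open import Data.Product.Base using (∃; ∃₂; _×_; _,_; proj₁; map₁)
open import Data.Sum.Base using (_⊎_; [_,_]′)
open import Data.Vec.Base as Vec using (Vec; lookup; replicate; zipWith; _[_]≔_)
import Data.Vec.Properties as Vec
import Data.Vec.Functional as Vector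
open Vector using (Vector)
import Data.Vec.Functional.Relation.Binary.Equality.Setoid as VectorEquality
open import Function.Bundles using (Bijection)
open import Function.Definitions using (Bijective)
open import Level using (Level; _⊔_)
open import Relation.Binary.Bundles using (Setoid)
import Relation.Binary.Construct.On as On
open import Relation.Binary.PropositionalEquality.Core using (_≡_)
import Relation.Binary.PropositionalEquality.Properties as ≡
open import Relation.Nullary.Decidable.Core using (does)
open import Relation.Nullary.Negation.Core using (¬_)
open import Relation.Unary using (Pred; _∈_)

private
  variable
    a i j m ℓm : Level
    n : ℕ

IsPrimePower : ℕ → Set
IsPrimePower q = ∃₂ λ p k → Prime p × 0 < k × q ≡ p ℕ.^ k

HasCardinality : Setoid i j → ℕ → Set (i ⊔ j)
HasCardinality S d = Bijection (≡.setoid (Fin d)) S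

module LinearAlgebra {c ℓ} (R : CommutativeRing c ℓ) where
  open CommutativeRing R

  module _ (V : RawLeftModule Carrier m ℓm) where
    open RawLeftModule V
    open MonoidOps +ᴹ-rawMonoid using (sum)

    combination : ∀ {d} → Vector Carrier d → Vector Carrierᴹ d → Carrierᴹ
    combination r b = sum λ k → r k *ₗ b k

    Spanning : ∀ {d} → Vector Carrierᴹ d → Set (c ⊔ m ⊔ ℓm)
    Spanning b = ∀ v → ∃ λ r → v ≈ᴹ combination r b

    Independent : ∀ {d} → Vector Carrierᴹ d → Set (c ⊔ ℓ ⊔ ℓm)
    Independent b = ∀ r → combination r b ≈ᴹ 0ᴹ → ∀ k → r k ≈ 0#

    HasDimension : ℕ → Set (c ⊔ ℓ ⊔ m ⊔ ℓm)
    HasDimension d = ∃ λ (b : Vector Carrierᴹ d) → Spanning b × Independent b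

    FiniteDimensional : Set (c ⊔ ℓ ⊔ m ⊔ ℓm)
    FiniteDimensional = ∃ λ d → HasDimension d

module Polynomials {c ℓ} (R : CommutativeRing c ℓ) where
  open CommutativeRing R
  open SemiringOps (RawRing.rawSemiring rawRing) using (_^_; product)

  -- A monomial is its vector of exponents.
  Monomial : ℕ → Set
  Monomial n = Vec ℕ n

  -- Formal sums of terms: monomials may repeat and coefficients may be zero,
  -- so polynomials are compared by total coefficients (_≈ᴾ_ below).
  Poly : ℕ → Set c
  Poly n = List (Carrier × Monomial n)

  coeff : Poly n → Monomial n → Carrier
  coeff []            μ = 0#
  coeff ((r , ν) ∷ f) μ =
    (if does (Vec.≡-dec ℕ._≟_ ν μ) then r else 0#) + coeff f μ

  -- A record rather than a function type, so that f and g can be inferred.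
  infix 4 _≈ᴾ_
  record _≈ᴾ_ (f g : Poly n) : Set ℓ where
    constructor mk≈ᴾ
    field
      coeff-≈ : ∀ μ → coeff f μ ≈ coeff g μ

  const : Carrier → Poly n
  const r = (r , replicate _ 0) ∷ []

  var : Fin n → Poly n
  var k = (1# , replicate _ 0 [ k ]≔ 1) ∷ []

  infixl 7 _*ᵗ_
  _*ᵗ_ : Carrier × Monomial n → Carrier × Monomial n → Carrier × Monomial n
  (r , μ) *ᵗ (s , ν) = r * s , zipWith ℕ._+_ μ ν

  polyRawRing : ℕ → RawRing c ℓ
  polyRawRing n = record
    { Carrier = Poly n
    ; _≈_     = _≈ᴾ_
    ; _+_     = _++_
    ; _*_     = List.cartesianProductWith _*ᵗ_
    ; -_      = List.map (map₁ (-_))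
    ; 0#      = []
    ; 1#      = const 1#
    }

  module _ {n : ℕ} where
    open RawRing (polyRawRing n) public
      using ()
      renaming (_+_ to _+ᴾ_; _*_ to _*ᴾ_; -_ to -ᴾ_; 0# to 0ᴾ; 1# to 1ᴾ)
    open SemiringOps (RawRing.rawSemiring (polyRawRing n)) public
      using ()
      renaming (_^_ to _^ᴾ_; sum to sumᴾ)

  infixl 6 _-ᴾ_
  _-ᴾ_ : Poly n → Poly n → Poly n
  f -ᴾ g = f +ᴾ (-ᴾ g)

  eval : Poly n → Vector Carrier n → Carrier
  eval []            s = 0#
  eval ((r , μ) ∷ f) s = r * product (λ k → s k ^ lookup μ k) + eval f s

  DegreesBelow : ℕ → Poly n → Set ℓ
  DegreesBelow d f = ∀ μ → ¬ (coeff f μ ≈ 0#) → ∀ k → lookup μ k < d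

module Ideals {c ℓ} (R : CommutativeRing c ℓ) where
  open CommutativeRing R using (Carrier; _≈_; 0#; setoid)
  open Polynomials R
  open LinearAlgebra R using (FiniteDimensional)

  -- The smallest ideal containing the family g.
  data ⟨_⟩ {A : Set a} (g : A → Poly n) : Pred (Poly n) (a ⊔ c ⊔ ℓ) where
    generator : ∀ x → g x ∈ ⟨ g ⟩
    zero∈     : 0ᴾ ∈ ⟨ g ⟩
    +-closed  : ∀ {f h} → f ∈ ⟨ g ⟩ → h ∈ ⟨ g ⟩ → f +ᴾ h ∈ ⟨ g ⟩
    *-closed  : ∀ f {h} → h ∈ ⟨ g ⟩ → f *ᴾ h ∈ ⟨ g ⟩
    ≈-closed  : ∀ {f h} → f ≈ᴾ h → f ∈ ⟨ g ⟩ → h ∈ ⟨ g ⟩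

  infixl 6 _+ᴵ_
  _+ᴵ_ : Pred (Poly n) i → Pred (Poly n) j → Pred (Poly n) (c ⊔ ℓ ⊔ i ⊔ j)
  (I +ᴵ J) f = ∃₂ λ g h → g ∈ I × h ∈ J × f ≈ᴾ g +ᴾ h

  Radical : Pred (Poly n) i → Set (c ⊔ i)
  Radical I = ∀ f k → f ^ᴾ k ∈ I → f ∈ I

  Quotient : Pred (Poly n) i → RawLeftModule Carrier c i
  Quotient {n = n} I = record
    { Carrierᴹ = Poly n
    ; _≈ᴹ_     = λ f g → f -ᴾ g ∈ I
    ; _+ᴹ_     = _+ᴾ_
    ; _*ₗ_     = λ r f → const r *ᴾ f
    ; 0ᴹ       = 0ᴾ
    ; -ᴹ_      = -ᴾ_
    }

  ZeroDimensional : Pred (Poly n) i → Set (c ⊔ ℓ ⊔ i)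
  ZeroDimensional I = FiniteDimensional (Quotient I)

  𝒵 : Pred (Poly n) i → Setoid (c ⊔ ℓ ⊔ i) ℓ
  𝒵 {n = n} I = On.setoid (VectorEquality.≋-setoid setoid n)
    (proj₁ {B = λ s → ∀ f → f ∈ I → eval f s ≈ 0#})

-- R plays the role of the field with q elements.
module PermutationIdeals {c ℓ} (R : CommutativeRing c ℓ) (q : ℕ) where
  open CommutativeRing R hiding (zero)
  open SemiringOps (RawRing.rawSemiring rawRing) using (_^_)
  open Polynomials R
  open Ideals R

  polySetoid : ℕ → Setoid c ℓ
  polySetoid n = record
    { Carrier       = Poly n
    ; _≈_           = _≈ᴾ_
    ; isEquivalence = record
      { refl  = mk≈ᴾ λ _ → refl
      ; sym   = λ (mk≈ᴾ f≈g) → mk≈ᴾ λ μ → sym (f≈g μ)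
      ; trans = λ (mk≈ᴾ f≈g) (mk≈ᴾ g≈h) → mk≈ᴾ λ μ → trans (f≈g μ) (g≈h μ)
      }
    }

  IsPermutation : (Carrier → Carrier) → Set (c ⊔ ℓ)
  IsPermutation = Bijective _≈_ _≈_

  eval₁ : Poly 1 → Carrier → Carrier
  eval₁ f x = eval f (x Vector.∷ Vector.[])

  eval₂ : Poly 2 → Carrier → Carrier → Carrier
  eval₂ f x y = eval f (x Vector.∷ y Vector.∷ Vector.[])

  IsPermutationPolynomial : Poly 1 → Set (c ⊔ ℓ)
  IsPermutationPolynomial f = DegreesBelow q f × IsPermutation (eval₁ f)

  IsLocalPermutationPolynomial : Poly 2 → Set (c ⊔ ℓ)
  IsLocalPermutationPolynomial f = DegreesBelow q f ×
    (∀ a → IsPermutation (λ x → eval₂ f x a) × IsPermutation (λ x → eval₂ f a x))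

  𝒫 : Setoid (c ⊔ ℓ) ℓ
  𝒫 = On.setoid (polySetoid 1) (proj₁ {B = IsPermutationPolynomial})

  ℒ𝒫 : Setoid (c ⊔ ℓ) ℓ
  ℒ𝒫 = On.setoid (polySetoid 2) (proj₁ {B = IsLocalPermutationPolynomial})

  -- The exponents 0, …, q − 2.
  Index : Set
  Index = Fin (q ∸ 1)

  Index² : Set
  Index² = Fin ((q ∸ 1) ℕ.* (q ∸ 1))

  -- The double index of x_{kl}, flattened.
  infix 8 _▸_
  _▸_ : Index → Index → Index²
  _▸_ = combine

  powerDiff : Carrier → Carrier → Index → Carrier
  powerDiff a b k = a ^ toℕ k - b ^ toℕ k

  F : Poly n → Poly n
  F f = f ^ᴾ (q ∸ 1) -ᴾ 1ᴾ

  DistinctPair : Set (c ⊔ ℓ)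
  DistinctPair = ∃₂ λ a b → ¬ (a ≈ b)

  F[_] : DistinctPair → Poly (q ∸ 1)
  F[ a , b , _ ] = F (sumᴾ λ k → const (powerDiff a b k) *ᴾ var k)

  Gʳᵒʷ Gᶜᵒˡ : DistinctPair × Carrier → Poly ((q ∸ 1) ℕ.* (q ∸ 1))
  Gʳᵒʷ ((a , b , _) , r) = F (sumᴾ λ k → sumᴾ λ l →
    const (powerDiff a b k * r ^ toℕ l) *ᴾ var (l ▸ k))
  Gᶜᵒˡ ((a , b , _) , r) = F (sumᴾ λ k → sumᴾ λ l →
    const (powerDiff a b k * r ^ toℕ l) *ᴾ var (k ▸ l))

  fieldEquation : Fin n → Poly n
  fieldEquation k = var k ^ᴾ q -ᴾ var k

  𝓘 : Pred (Poly (q ∸ 1)) (c ⊔ ℓ)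
  𝓘 = ⟨ F[_] ⟩ +ᴵ ⟨ fieldEquation ⟩

  𝓙 : Pred (Poly ((q ∸ 1) ℕ.* (q ∸ 1))) (c ⊔ ℓ)
  𝓙 = ⟨ [ Gʳᵒʷ , Gᶜᵒˡ ]′ ⟩ +ᴵ ⟨ (λ ((k , l) : Index × Index) → fieldEquation (k ▸ l)) ⟩

  toPoly₁ : Vector Carrier (q ∸ 1) → Poly 1
  toPoly₁ s = sumᴾ λ k → const (s k) *ᴾ var zero ^ᴾ toℕ k

  toPoly₂ : Vector Carrier ((q ∸ 1) ℕ.* (q ∸ 1)) → Poly 2
  toPoly₂ s = sumᴾ λ k → sumᴾ λ l →
    const (s (k ▸ l)) *ᴾ (var zero ^ᴾ toℕ k *ᴾ var (suc zero) ^ᴾ toℕ l)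

{-# OPTIONS --safe #-}

-- For an ideal I of F_q[X] containing all x_k^q - x_k, let E_s be the product over k of Lagrange's
-- idempotents at s_k in x_k. Modulo I we have x_k E_s = s_k E_s, hence f E_s = f(s) E_s for every f,
-- and the E_s sum to 1. If s is not a zero of I, then some f in I with f(s) invertible gives
-- E_s = 0. So f = Σ f(s) E_s over the zeros s of I: these E_s form a basis of the quotient, and
-- I consists of all polynomials vanishing on its zeros, which makes it radical.
--
-- Since x^(q-1) is 1 or 0 according as x ≠ 0 or x = 0, the generators vanish at s iff the polynomial
-- maps with coefficients s separate points. That every (local) permutation polynomial has
-- degree at most q - 2 holds because the values of a polynomial of degree < q sum to minus
-- its coefficient of x^(q-1), whereas the elements of the field sum to 0.

module Submission where

open import Defs
open import Algebra.Apartness.Bundles using (HeytingField; HeytingCommutativeRing)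
open import Algebra.Bundles using (CommutativeMonoid; CommutativeRing; RawRing)
import Algebra.Definitions.RawSemiring as SemiringOps
open import Algebra.Morphism.Structures using (module SemiringMorphisms)
import Algebra.Properties.CommutativeMonoid.Sum as MonoidSum
import Algebra.Properties.CommutativeSemigroup as CommutativeSemigroupProperties
import Algebra.Properties.CommutativeSemiring.Exp as Exponentiation
import Algebra.Properties.Group as GroupProperties
import Algebra.Properties.Ring as RingProperties
import Algebra.Properties.Semiring.Sum as SemiringSum
open import Data.Bool.Base using (if_then_else_; true; false)
open import Data.Fin.Base as Fin using
  ( Fin; zero; suc; toℕ; fromℕ; fromℕ<; punchIn; punchOut; _↑ˡ_; _↑ʳ_
  ; combine; quotient; remainder; finToFun; funToFin)
import Data.Fin.Permutation as Permutation
import Data.Fin.Properties as Fin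
open import Data.List.Base as List using ([]; _∷_; _++_)
open import Data.Nat.Base as ℕ using (ℕ; zero; suc; _<_; _>_; z≤n; s≤s)
import Data.Nat.Properties as ℕ
open import Data.Product.Base using (∃; _×_; _,_; proj₁; proj₂)
open import Data.Sum.Base using (_⊎_; inj₁; inj₂; [_,_]′)
open import Data.Vec.Base as Vec using ([]; _∷_; lookup; replicate; zipWith; _[_]≔_)
import Data.Vec.Properties as Vec
open import Data.Vec.Functional as Vector using (Vector; removeAt)
open import Function.Base using (_∘_; id)
open import Function.Bundles using (Bijection)
import Function.Construct.Composition as Composition
open import Level using (Level; _⊔_) renaming (suc to lsuc)
open import Relation.Binary.Bundles using (Setoid)
open import Relation.Binary.PropositionalEquality as ≡ using (_≡_; _≢_)
import Relation.Binary.Reasoning.Setoid as SetoidReasoning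
open import Relation.Nullary.Decidable using (Dec; does; yes; no; map′; dec-true; _×-dec_; ¬?)
open import Relation.Nullary.Negation.Core using (¬_; contradiction)
open import Relation.Unary using (Pred; _∈_; Decidable)

-- Everything has to be constructive, and ideal membership by itself offers no test. The case
-- distinction between zeros of I and other points therefore needs a source: a finite field has
-- decidable equality through indices, the generators can be tested at a point by a finite search
-- for collisions, and a generator that does not vanish there is the required f. Finiteness also
-- turns nonzero elements into invertible ones. Lagrange's idempotent is used in the form 1 -
-- a^(q-1) - X (X^(q-1) - a^(q-1))/(X - a). No binomial coefficients and no characteristic enter:
-- the multiplication rule follows from a^q = a and X^q = X, the sum over all a from the power sums
-- of the field, which also bound the degrees of permutation polynomials. So the idempotents make
-- sense in any commutative algebra over the field, in particular modulo I, and their values at the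
-- zeros of I follow from congruences. Throughout, q is `suc m`, so `m` is the exponent in F and the
-- number of coefficients in each variable.

-- Enumerations of decidable subsets and of functions between finite sets

record Selection {p} (a b : Level) {n} (P : Pred (Fin n) p) : Set (p ⊔ lsuc (a ⊔ b)) where
  field
    size     : ℕ
    pick     : Fin size → Fin n
    sound    : ∀ j → P (pick j)
    distinct : ∀ {i j} → pick i ≡ pick j → i ≡ j
    complete : ∀ {i} → P i → ∃ λ j → pick j ≡ i
    -- Proved along the same recursion that builds `pick`. It later removes from a sum over all
    -- points the terms of those that are not zeros of the ideal.
    sum-pick : (M : CommutativeMonoid a b) → let open CommutativeMonoid M in
      (t : Vector Carrier n) → (∀ {i} → ¬ P i → t i ≈ ε) → MonoidSum.sum M t ≈ MonoidSum.sum M (t ∘ pick)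

select : ∀ {p a b n} {P : Pred (Fin n) p} → Decidable P → Selection a b P
select {n = zero}  P? = record
  { size = 0 ; pick = λ () ; sound = λ () ; distinct = λ { {()} } ; complete = λ { {()} }
  ; sum-pick = λ M t _ → CommutativeMonoid.refl M }
select {n = suc n} {P} P? with P? zero | select {P = P ∘ suc} (P? ∘ suc)
... | no ¬P₀ | S = record
  { size     = S.size
  ; pick     = suc ∘ S.pick
  ; sound    = S.sound
  ; distinct = S.distinct ∘ Fin.suc-injective
  ; complete = λ { {zero}  P₀ → contradiction P₀ ¬P₀
                 ; {suc i} Pᵢ → let j , eq = S.complete Pᵢ in j , ≡.cong suc eq }
  ; sum-pick = λ M t outside → let open CommutativeMonoid M in
      trans (∙-cong (outside ¬P₀) (S.sum-pick M (t ∘ suc) outside)) (identityˡ _)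
  } where module S = Selection S
... | yes P₀ | S = record
  { size     = suc S.size
  ; pick     = λ { zero → zero ; (suc j) → suc (S.pick j) }
  ; sound    = λ { zero → P₀ ; (suc j) → S.sound j }
  ; distinct = λ { {zero}  {zero}  _  → ≡.refl
                 ; {suc i} {suc j} eq → ≡.cong suc (S.distinct (Fin.suc-injective eq)) }
  ; complete = λ { {zero}  _  → zero , ≡.refl
                 ; {suc i} Pᵢ → let j , eq = S.complete Pᵢ in suc j , ≡.cong suc eq }
  ; sum-pick = λ M t outside → CommutativeMonoid.∙-congˡ M (S.sum-pick M (t ∘ suc) outside)
  } where module S = Selection S

-- Functions are compared pointwise, so the code of a function must be seen to depend on its values
-- alone before `funToFin` can serve as a left inverse of `finToFun`.
funToFin-cong : ∀ {k n} {f g : Fin n → Fin k} → (∀ i → f i ≡ g i) → funToFin f ≡ funToFin g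
funToFin-cong {n = zero}  eq = ≡.refl
funToFin-cong {n = suc n} eq = ≡.cong₂ combine (eq zero) (funToFin-cong (eq ∘ suc))

finToFun-injective : ∀ {k n} (p p′ : Fin (k ℕ.^ n)) →
  (∀ i → finToFun {k} {n} p i ≡ finToFun {k} {n} p′ i) → p ≡ p′
finToFun-injective {k} {n} p p′ eq = ≡.trans (≡.sym (Fin.funToFin-finToFin {n} {k} p))
  (≡.trans (funToFin-cong {k} {n} eq) (Fin.funToFin-finToFin {n} {k} p′))

-- Finite sums and products in a commutative ring

module Distributivity {c ℓ} (R : CommutativeRing c ℓ) where
  open CommutativeRing R hiding (zero)
  open SemiringOps (RawRing.rawSemiring rawRing) using (product; sum)
  open SemiringSum semiring using (sum-cong-≋; *-distribˡ-sum; *-distribʳ-sum)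
  open SetoidReasoning setoid

  sum-split : ∀ k l (t : Vector Carrier (k ℕ.+ l)) →
    sum t ≈ sum (λ i → t (i ↑ˡ l)) + sum (λ j → t (k ↑ʳ j))
  sum-split zero    l t = sym (+-identityˡ _)
  sum-split (suc k) l t = trans (+-congˡ (sum-split k l (t ∘ suc))) (sym (+-assoc _ _ _))

  sum-combine : ∀ k l (t : Vector Carrier (k ℕ.* l)) →
    sum t ≈ sum λ i → sum λ j → t (combine {k} {l} i j)
  sum-combine zero    l t = refl
  sum-combine (suc k) l t = trans (sum-split l (k ℕ.* l) t) (+-congˡ (sum-combine k l (λ j → t (l ↑ʳ j))))

  -- Expanding a product of sums chooses one summand in every factor; `p` encodes the choice
  -- function. Its value at `zero` is the leading digit of `p` in base `k`, hence the split into
  -- `quotient` and `remainder`.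
  product-sum : ∀ k n (g : Fin n → Fin k → Carrier) →
    sum (λ (p : Fin (k ℕ.^ n)) → product λ i → g i (finToFun {k} {n} p i)) ≈ product λ i → sum (g i)
  product-sum k zero    g = +-identityʳ _
  product-sum k (suc n) g = begin
    sum (λ (p : Fin (k ℕ.^ suc n)) → term (quotient {k} (k ℕ.^ n) p) (remainder {k} (k ℕ.^ n) p))
      ≈⟨ sum-combine k (k ℕ.^ n) (λ p → term (quotient {k} (k ℕ.^ n) p) (remainder {k} (k ℕ.^ n) p)) ⟩
    sum (λ i → sum λ j → term (quotient {k} (k ℕ.^ n) (combine {k} {k ℕ.^ n} i j))
                                 (remainder {k} (k ℕ.^ n) (combine {k} {k ℕ.^ n} i j)))
      ≈⟨ sum-cong-≋ {k} (λ i → sum-cong-≋ {k ℕ.^ n} λ j → reflexive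
           (≡.cong (λ (i , j) → term i j) (Fin.remQuot-combine {k} {k ℕ.^ n} i j))) ⟩
    sum (λ i → sum λ j → term i j)
      ≈⟨ sum-cong-≋ {k} (λ i → *-distribˡ-sum (g zero i) rest) ⟨
    sum (λ i → g zero i * sum rest)
      ≈⟨ *-distribʳ-sum (sum rest) (g zero) ⟨
    sum (g zero) * sum rest
      ≈⟨ *-congˡ (product-sum k n (g ∘ suc)) ⟩
    sum (g zero) * product (λ i → sum (g (suc i))) ∎
    where
    rest : Vector Carrier (k ℕ.^ n)
    rest j = product λ i → g (suc i) (finToFun {k} {n} j i)
    term : Fin k → Fin (k ℕ.^ n) → Carrier
    term i j = g zero i * rest j

  -- The exchange of scalars takes place in a single factor. This carries the multiplication rule
  -- from the idempotent in one variable to the idempotent of a point.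
  *-product-cong : ∀ {n} (t : Vector Carrier n) k {x y} → x * t k ≈ y * t k →
    x * product t ≈ y * product t
  *-product-cong t zero    {x} {y} eq =
    trans (sym (*-assoc _ _ _)) (trans (*-congʳ eq) (*-assoc _ _ _))
  *-product-cong t (suc k) {x} {y} eq =
    trans (x∙yz≈y∙xz _ _ _) (trans (*-congˡ (*-product-cong (t ∘ suc) k eq)) (x∙yz≈y∙xz _ _ _))
    where open CommutativeSemigroupProperties *-commutativeSemigroup using (x∙yz≈y∙xz)

  -- An equation f x = a x makes f act on x as the scalar a. Such actions add here and multiply in
  -- `absorb-*`, which extends the rule for the variables to all polynomials.
  absorb-+ : ∀ {f g a b x} → f * x ≈ a * x → g * x ≈ b * x → (f + g) * x ≈ (a + b) * x
  absorb-+ fx gx = trans (distribʳ _ _ _) (trans (+-cong fx gx) (sym (distribʳ _ _ _)))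

  absorb-* : ∀ {f g a b x} → f * x ≈ a * x → g * x ≈ b * x → (f * g) * x ≈ (a * b) * x
  absorb-* {f} {g} {a} {b} {x} fx gx = begin
    f * g * x      ≈⟨ *-assoc f g x ⟩
    f * (g * x)    ≈⟨ *-congˡ gx ⟩
    f * (b * x)    ≈⟨ x∙yz≈y∙xz f b x ⟩
    b * (f * x)    ≈⟨ *-congˡ fx ⟩
    b * (a * x)    ≈⟨ x∙yz≈y∙xz b a x ⟩
    a * (b * x)    ≈⟨ *-assoc a b x ⟨
    a * b * x      ∎
    where open CommutativeSemigroupProperties *-commutativeSemigroup using (x∙yz≈y∙xz)

  invertible-cancelˡ-zero : ∀ {x y z} → z * x ≈ 1# → x * y ≈ 0# → y ≈ 0#
  invertible-cancelˡ-zero {x} {y} {z} zx≈1 xy≈0 = begin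
    y              ≈⟨ *-identityˡ y ⟨
    1# * y         ≈⟨ *-congʳ zx≈1 ⟨
    z * x * y      ≈⟨ *-assoc z x y ⟩
    z * (x * y)    ≈⟨ *-congˡ xy≈0 ⟩
    z * 0#         ≈⟨ zeroʳ z ⟩
    0#             ∎

-- Ring structure and evaluation of polynomials given as lists of terms

module PolynomialRing {c ℓ} (R : CommutativeRing c ℓ) where
  open CommutativeRing R hiding (zero)
  open Polynomials R
  open RingProperties ring using (-‿distribˡ-*; -0#≈0#; -‿+-comm)
  open CommutativeSemigroupProperties +-commutativeSemigroup using () renaming (interchange to +-interchange)
  open CommutativeSemigroupProperties *-commutativeSemigroup using (x∙yz≈y∙xz)
  open GroupProperties +-group using (x∙y⁻¹≈ε⇒x≈y; x≈y⇒x∙y⁻¹≈ε)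
  open SetoidReasoning setoid

  private
    variable
      n : ℕ

  _+ᵐ_ : Monomial n → Monomial n → Monomial n
  _+ᵐ_ = zipWith ℕ._+_

  -- The linear extension of φ to polynomials. Both coefficients and evaluation are of this form,
  -- and f ≈ᴾ g means that all linear functionals agree on f and g.
  pairing : Poly n → (Monomial n → Carrier) → Carrier
  pairing []            φ = 0#
  pairing ((r , μ) ∷ f) φ = r * φ μ + pairing f φ

  pairing-cong : ∀ (f : Poly n) {φ ψ} → (∀ μ → φ μ ≈ ψ μ) → pairing f φ ≈ pairing f ψ
  pairing-cong []            eq = refl
  pairing-cong ((r , μ) ∷ f) eq = +-cong (*-congˡ (eq μ)) (pairing-cong f eq)

  pairing-++ : ∀ (f g : Poly n) φ → pairing (f ++ g) φ ≈ pairing f φ + pairing g φ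
  pairing-++ []            g φ = sym (+-identityˡ _)
  pairing-++ ((r , μ) ∷ f) g φ = trans (+-congˡ (pairing-++ f g φ)) (sym (+-assoc _ _ _))

  pairing-neg : ∀ (f : Poly n) φ → pairing (-ᴾ f) φ ≈ - pairing f φ
  pairing-neg []            φ = sym -0#≈0#
  pairing-neg ((r , μ) ∷ f) φ =
    trans (+-cong (sym (-‿distribˡ-* _ _)) (pairing-neg f φ)) (-‿+-comm _ _)

  pairing-scale : ∀ r (f : Poly n) φ → r * pairing f φ ≈ pairing f (λ μ → r * φ μ)
  pairing-scale r []            φ = zeroʳ r
  pairing-scale r ((s , μ) ∷ f) φ =
    trans (distribˡ _ _ _) (+-cong (x∙yz≈y∙xz _ _ _) (pairing-scale r f φ))

  pairing-+ : ∀ (f : Poly n) φ ψ → pairing f (λ μ → φ μ + ψ μ) ≈ pairing f φ + pairing f ψ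
  pairing-+ []            φ ψ = sym (+-identityˡ _)
  pairing-+ ((r , μ) ∷ f) φ ψ =
    trans (+-cong (distribˡ _ _ _) (pairing-+ f φ ψ)) (+-interchange _ _ _ _)

  pairing-0 : ∀ (f : Poly n) → pairing f (λ _ → 0#) ≈ 0#
  pairing-0 []            = refl
  pairing-0 ((r , μ) ∷ f) = trans (+-cong (zeroʳ r) (pairing-0 f)) (+-identityˡ _)

  pairing-swap : ∀ (f g : Poly n) (ψ : Monomial n → Monomial n → Carrier) →
    pairing f (λ μ → pairing g (ψ μ)) ≈ pairing g (λ ν → pairing f (λ μ → ψ μ ν))
  pairing-swap []            g ψ = sym (pairing-0 g)
  pairing-swap ((r , μ) ∷ f) g ψ = begin
    r * pairing g (ψ μ) + pairing f (λ μ′ → pairing g (ψ μ′))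
      ≈⟨ +-cong (pairing-scale r g (ψ μ)) (pairing-swap f g ψ) ⟩
    pairing g (λ ν → r * ψ μ ν) + pairing g (λ ν → pairing f (λ μ′ → ψ μ′ ν))
      ≈⟨ pairing-+ g _ _ ⟨
    pairing g (λ ν → r * ψ μ ν + pairing f (λ μ′ → ψ μ′ ν)) ∎

  pairing-*ᵗ : ∀ r μ (g : Poly n) φ →
    pairing (List.map ((r , μ) *ᵗ_) g) φ ≈ r * pairing g (λ ν → φ (μ +ᵐ ν))
  pairing-*ᵗ r μ []            φ = sym (zeroʳ r)
  pairing-*ᵗ r μ ((s , ν) ∷ g) φ =
    trans (+-cong (*-assoc _ _ _) (pairing-*ᵗ r μ g φ)) (sym (distribˡ _ _ _))

  -- Multiplication is dual to addition of exponents. Commutativity and associativity of `_*ᴾ_`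
  -- thereby reduce to those of `_+ᵐ_` and to the exchange of two pairings.
  pairing-* : ∀ (f g : Poly n) φ →
    pairing (f *ᴾ g) φ ≈ pairing f (λ μ → pairing g (λ ν → φ (μ +ᵐ ν)))
  pairing-* []            g φ = refl
  pairing-* ((r , μ) ∷ f) g φ =
    trans (pairing-++ (List.map ((r , μ) *ᵗ_) g) _ φ) (+-cong (pairing-*ᵗ r μ g φ) (pairing-* f g φ))

  indicator : Monomial n → Monomial n → Carrier
  indicator μ ν = if does (Vec.≡-dec ℕ._≟_ ν μ) then 1# else 0#

  coeff≈pairing : ∀ (f : Poly n) μ → coeff f μ ≈ pairing f (indicator μ)
  coeff≈pairing []            μ = refl
  coeff≈pairing ((r , ν) ∷ f) μ with does (Vec.≡-dec ℕ._≟_ ν μ)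
  ... | true  = +-cong (sym (*-identityʳ r)) (coeff≈pairing f μ)
  ... | false = +-cong (sym (zeroʳ r)) (coeff≈pairing f μ)

  -- Monomials may repeat in the list, so a zero coefficient can arise by cancellation between
  -- distant terms; all occurrences have to be removed together.
  dropMonomial : Monomial n → Poly n → Poly n
  dropMonomial ν []            = []
  dropMonomial ν ((r , μ) ∷ f) with does (Vec.≡-dec ℕ._≟_ μ ν)
  ... | true  = dropMonomial ν f
  ... | false = (r , μ) ∷ dropMonomial ν f

  dropMonomial-length : ∀ ν (f : Poly n) → List.length (dropMonomial ν f) ℕ.≤ List.length f
  dropMonomial-length ν []            = ℕ.z≤n
  dropMonomial-length ν ((r , μ) ∷ f) with does (Vec.≡-dec ℕ._≟_ μ ν)
  ... | true  = ℕ.m≤n⇒m≤1+n (dropMonomial-length ν f)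
  ... | false = ℕ.s≤s (dropMonomial-length ν f)

  pairing-dropMonomial : ∀ ν (f : Poly n) φ →
    pairing f φ ≈ coeff f ν * φ ν + pairing (dropMonomial ν f) φ
  pairing-dropMonomial ν []            φ = sym (trans (+-identityʳ _) (zeroˡ _))
  pairing-dropMonomial ν ((r , μ) ∷ f) φ with Vec.≡-dec ℕ._≟_ μ ν
  ... | yes ≡.refl = begin
    r * φ μ + pairing f φ                                            ≈⟨ +-congˡ (pairing-dropMonomial μ f φ) ⟩
    r * φ μ + (coeff f μ * φ μ + pairing (dropMonomial μ f) φ)       ≈⟨ +-assoc _ _ _ ⟨
    r * φ μ + coeff f μ * φ μ + pairing (dropMonomial μ f) φ         ≈⟨ +-congʳ (distribʳ _ _ _) ⟨
    (r + coeff f μ) * φ μ + pairing (dropMonomial μ f) φ             ∎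
  ... | no _ = begin
    r * φ μ + pairing f φ                                            ≈⟨ +-congˡ (pairing-dropMonomial ν f φ) ⟩
    r * φ μ + (coeff f ν * φ ν + pairing (dropMonomial ν f) φ)       ≈⟨ +-assoc _ _ _ ⟨
    r * φ μ + coeff f ν * φ ν + pairing (dropMonomial ν f) φ         ≈⟨ +-congʳ (+-comm _ _) ⟩
    coeff f ν * φ ν + r * φ μ + pairing (dropMonomial ν f) φ         ≈⟨ +-assoc _ _ _ ⟩
    coeff f ν * φ ν + (r * φ μ + pairing (dropMonomial ν f) φ)       ≈⟨ +-congʳ (*-congʳ (+-identityˡ _)) ⟨
    (0# + coeff f ν) * φ ν + (r * φ μ + pairing (dropMonomial ν f) φ) ∎

  private
    pairing-vanishes : ∀ k (f : Poly n) → List.length f ℕ.≤ k → (∀ μ → coeff f μ ≈ 0#) →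
      ∀ φ → pairing f φ ≈ 0#
    pairing-vanishes k       []                _           f≈0 φ = refl
    pairing-vanishes (suc k) ((r , ν) ∷ f) (ℕ.s≤s len) f≈0 φ = begin
      pairing g φ                            ≈⟨ pairing-g φ ⟩
      pairing (dropMonomial ν f) φ           ≈⟨ pairing-vanishes k (dropMonomial ν f)
                                                  (ℕ.≤-trans (dropMonomial-length ν f) len) rest≈0 φ ⟩
      0#                                     ∎
      where
      g = (r , ν) ∷ f
      drop-g : dropMonomial ν g ≡ dropMonomial ν f
      drop-g rewrite dec-true (Vec.≡-dec ℕ._≟_ ν ν) ≡.refl = ≡.refl
      pairing-g : ∀ ψ → pairing g ψ ≈ pairing (dropMonomial ν f) ψ
      pairing-g ψ = begin
        pairing g ψ                                        ≈⟨ pairing-dropMonomial ν g ψ ⟩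
        coeff g ν * ψ ν + pairing (dropMonomial ν g) ψ     ≈⟨ +-congʳ (trans (*-congʳ (f≈0 ν)) (zeroˡ _)) ⟩
        0# + pairing (dropMonomial ν g) ψ                  ≈⟨ +-identityˡ _ ⟩
        pairing (dropMonomial ν g) ψ                       ≡⟨ ≡.cong (λ h → pairing h ψ) drop-g ⟩
        pairing (dropMonomial ν f) ψ                       ∎
      rest≈0 : ∀ μ → coeff (dropMonomial ν f) μ ≈ 0#
      rest≈0 μ = begin
        coeff (dropMonomial ν f) μ                ≈⟨ coeff≈pairing (dropMonomial ν f) μ ⟩
        pairing (dropMonomial ν f) (indicator μ)  ≈⟨ pairing-g (indicator μ) ⟨
        pairing g (indicator μ)                   ≈⟨ coeff≈pairing g μ ⟨
        coeff g μ                                 ≈⟨ f≈0 μ ⟩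
        0#                                        ∎

  coeff-+ : ∀ (f g : Poly n) μ → coeff (f +ᴾ g) μ ≈ coeff f μ + coeff g μ
  coeff-+ f g μ = begin
    coeff (f +ᴾ g) μ                                  ≈⟨ coeff≈pairing (f +ᴾ g) μ ⟩
    pairing (f +ᴾ g) (indicator μ)                    ≈⟨ pairing-++ f g _ ⟩
    pairing f (indicator μ) + pairing g (indicator μ) ≈⟨ +-cong (coeff≈pairing f μ) (coeff≈pairing g μ) ⟨
    coeff f μ + coeff g μ                             ∎

  coeff-neg : ∀ (f : Poly n) μ → coeff (-ᴾ f) μ ≈ - coeff f μ
  coeff-neg f μ = begin
    coeff (-ᴾ f) μ               ≈⟨ coeff≈pairing (-ᴾ f) μ ⟩
    pairing (-ᴾ f) (indicator μ) ≈⟨ pairing-neg f _ ⟩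
    - pairing f (indicator μ)    ≈⟨ -‿cong (coeff≈pairing f μ) ⟨
    - coeff f μ                  ∎

  -- Coefficients are pairings with indicators only. The passage to arbitrary functionals is what
  -- makes products and evaluation compatible with `_≈ᴾ_`.
  pairing-respects : ∀ {f g : Poly n} → f ≈ᴾ g → ∀ φ → pairing f φ ≈ pairing g φ
  pairing-respects {f = f} {g} (mk≈ᴾ f≈g) φ = x∙y⁻¹≈ε⇒x≈y _ _ (begin
    pairing f φ + - pairing g φ      ≈⟨ +-congˡ (pairing-neg g φ) ⟨
    pairing f φ + pairing (-ᴾ g) φ   ≈⟨ pairing-++ f (-ᴾ g) φ ⟨
    pairing (f -ᴾ g) φ               ≈⟨ pairing-vanishes _ (f -ᴾ g) ℕ.≤-refl diff≈0 φ ⟩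
    0#                               ∎)
    where
    diff≈0 : ∀ μ → coeff (f -ᴾ g) μ ≈ 0#
    diff≈0 μ = begin
      coeff (f -ᴾ g) μ            ≈⟨ coeff-+ f (-ᴾ g) μ ⟩
      coeff f μ + coeff (-ᴾ g) μ  ≈⟨ +-congˡ (coeff-neg g μ) ⟩
      coeff f μ - coeff g μ       ≈⟨ x≈y⇒x∙y⁻¹≈ε (f≈g μ) ⟩
      0#                          ∎

  ≈ᴾ-by-pairing : ∀ {f g : Poly n} → (∀ φ → pairing f φ ≈ pairing g φ) → f ≈ᴾ g
  ≈ᴾ-by-pairing {f = f} {g} eq = mk≈ᴾ λ μ →
    trans (coeff≈pairing f μ) (trans (eq (indicator μ)) (sym (coeff≈pairing g μ)))

  +ᵐ-comm : ∀ (μ ν : Monomial n) → μ +ᵐ ν ≡ ν +ᵐ μ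
  +ᵐ-comm = Vec.zipWith-comm ℕ.+-comm

  +ᵐ-assoc : ∀ (μ ν κ : Monomial n) → (μ +ᵐ ν) +ᵐ κ ≡ μ +ᵐ (ν +ᵐ κ)
  +ᵐ-assoc = Vec.zipWith-assoc ℕ.+-assoc

  +ᵐ-identityˡ : ∀ (μ : Monomial n) → replicate n 0 +ᵐ μ ≡ μ
  +ᵐ-identityˡ = Vec.zipWith-identityˡ ℕ.+-identityˡ

  private
    *ᴾ-comm : ∀ (f g : Poly n) → f *ᴾ g ≈ᴾ g *ᴾ f
    *ᴾ-comm f g = ≈ᴾ-by-pairing λ φ → begin
      pairing (f *ᴾ g) φ                                ≈⟨ pairing-* f g φ ⟩
      pairing f (λ μ → pairing g (λ ν → φ (μ +ᵐ ν)))    ≈⟨ pairing-swap f g _ ⟩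
      pairing g (λ ν → pairing f (λ μ → φ (μ +ᵐ ν)))    ≈⟨ pairing-cong g (λ ν → pairing-cong f λ μ →
                                                             reflexive (≡.cong φ (+ᵐ-comm μ ν))) ⟩
      pairing g (λ ν → pairing f (λ μ → φ (ν +ᵐ μ)))    ≈⟨ pairing-* g f φ ⟨
      pairing (g *ᴾ f) φ                                ∎

    *ᴾ-assoc : ∀ (f g h : Poly n) → (f *ᴾ g) *ᴾ h ≈ᴾ f *ᴾ (g *ᴾ h)
    *ᴾ-assoc f g h = ≈ᴾ-by-pairing λ φ → begin
      pairing ((f *ᴾ g) *ᴾ h) φ
        ≈⟨ trans (pairing-* (f *ᴾ g) h φ) (pairing-* f g _) ⟩
      pairing f (λ μ → pairing g (λ ν → pairing h (λ κ → φ ((μ +ᵐ ν) +ᵐ κ))))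
        ≈⟨ pairing-cong f (λ μ → pairing-cong g λ ν → pairing-cong h λ κ →
             reflexive (≡.cong φ (+ᵐ-assoc μ ν κ))) ⟩
      pairing f (λ μ → pairing g (λ ν → pairing h (λ κ → φ (μ +ᵐ (ν +ᵐ κ)))))
        ≈⟨ trans (pairing-* f (g *ᴾ h) φ) (pairing-cong f (λ μ → pairing-* g h _)) ⟨
      pairing (f *ᴾ (g *ᴾ h)) φ ∎

    *ᴾ-cong : ∀ {f f′ g g′ : Poly n} → f ≈ᴾ f′ → g ≈ᴾ g′ → f *ᴾ g ≈ᴾ f′ *ᴾ g′
    *ᴾ-cong {f = f} {f′} {g} {g′} f≈f′ g≈g′ = ≈ᴾ-by-pairing λ φ → begin
      pairing (f *ᴾ g) φ                                 ≈⟨ pairing-* f g φ ⟩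
      pairing f (λ μ → pairing g (λ ν → φ (μ +ᵐ ν)))     ≈⟨ pairing-cong f (λ μ → pairing-respects g≈g′ _) ⟩
      pairing f (λ μ → pairing g′ (λ ν → φ (μ +ᵐ ν)))    ≈⟨ pairing-respects f≈f′ _ ⟩
      pairing f′ (λ μ → pairing g′ (λ ν → φ (μ +ᵐ ν)))   ≈⟨ pairing-* f′ g′ φ ⟨
      pairing (f′ *ᴾ g′) φ                               ∎

    *ᴾ-identityˡ : ∀ (f : Poly n) → 1ᴾ *ᴾ f ≈ᴾ f
    *ᴾ-identityˡ f = ≈ᴾ-by-pairing λ φ → begin
      pairing (1ᴾ *ᴾ f) φ                                ≈⟨ pairing-* 1ᴾ f φ ⟩
      1# * pairing f (λ μ → φ (replicate _ 0 +ᵐ μ)) + 0# ≈⟨ trans (+-identityʳ _) (*-identityˡ _) ⟩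
      pairing f (λ μ → φ (replicate _ 0 +ᵐ μ))           ≈⟨ pairing-cong f (λ μ →
                                                              reflexive (≡.cong φ (+ᵐ-identityˡ μ))) ⟩
      pairing f φ                                        ∎

    *ᴾ-distribʳ : ∀ (f g h : Poly n) → (g +ᴾ h) *ᴾ f ≈ᴾ g *ᴾ f +ᴾ h *ᴾ f
    *ᴾ-distribʳ f g h = ≈ᴾ-by-pairing λ φ → begin
      pairing ((g +ᴾ h) *ᴾ f) φ                  ≈⟨ trans (pairing-* (g +ᴾ h) f φ) (pairing-++ g h _) ⟩
      pairing g _ + pairing h _                  ≈⟨ +-cong (pairing-* g f φ) (pairing-* h f φ) ⟨
      pairing (g *ᴾ f) φ + pairing (h *ᴾ f) φ    ≈⟨ pairing-++ (g *ᴾ f) (h *ᴾ f) φ ⟨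
      pairing (g *ᴾ f +ᴾ h *ᴾ f) φ               ∎

    +ᴾ-comm : ∀ (f g : Poly n) → f +ᴾ g ≈ᴾ g +ᴾ f
    +ᴾ-comm f g = ≈ᴾ-by-pairing λ φ →
      trans (pairing-++ f g φ) (trans (+-comm _ _) (sym (pairing-++ g f φ)))

    +ᴾ-cong : ∀ {f f′ g g′ : Poly n} → f ≈ᴾ f′ → g ≈ᴾ g′ → f +ᴾ g ≈ᴾ f′ +ᴾ g′
    +ᴾ-cong {f = f} {f′} {g} {g′} f≈f′ g≈g′ = ≈ᴾ-by-pairing λ φ →
      trans (pairing-++ f g φ)
        (trans (+-cong (pairing-respects f≈f′ φ) (pairing-respects g≈g′ φ)) (sym (pairing-++ f′ g′ φ)))

    +ᴾ-assoc : ∀ (f g h : Poly n) → (f +ᴾ g) +ᴾ h ≈ᴾ f +ᴾ (g +ᴾ h)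
    +ᴾ-assoc f g h = ≈ᴾ-by-pairing λ φ → begin
      pairing ((f +ᴾ g) +ᴾ h) φ                     ≈⟨ trans (pairing-++ (f +ᴾ g) h φ) (+-congʳ (pairing-++ f g φ)) ⟩
      pairing f φ + pairing g φ + pairing h φ       ≈⟨ +-assoc _ _ _ ⟩
      pairing f φ + (pairing g φ + pairing h φ)     ≈⟨ trans (pairing-++ f (g +ᴾ h) φ) (+-congˡ (pairing-++ g h φ)) ⟨
      pairing (f +ᴾ (g +ᴾ h)) φ                     ∎

    +ᴾ-identityʳ : ∀ (f : Poly n) → f +ᴾ 0ᴾ ≈ᴾ f
    +ᴾ-identityʳ f = ≈ᴾ-by-pairing λ φ → trans (pairing-++ f 0ᴾ φ) (+-identityʳ _)

    -ᴾ-inverseʳ : ∀ (f : Poly n) → f +ᴾ (-ᴾ f) ≈ᴾ 0ᴾ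
    -ᴾ-inverseʳ f = ≈ᴾ-by-pairing λ φ →
      trans (pairing-++ f (-ᴾ f) φ) (trans (+-congˡ (pairing-neg f φ)) (-‿inverseʳ _))

    -ᴾ-cong : ∀ {f g : Poly n} → f ≈ᴾ g → -ᴾ f ≈ᴾ -ᴾ g
    -ᴾ-cong {f = f} {g} f≈g = ≈ᴾ-by-pairing λ φ →
      trans (pairing-neg f φ) (trans (-‿cong (pairing-respects f≈g φ)) (sym (pairing-neg g φ)))

    ≈ᴾ-refl : ∀ {f : Poly n} → f ≈ᴾ f
    ≈ᴾ-refl = mk≈ᴾ λ _ → refl

    ≈ᴾ-sym : ∀ {f g : Poly n} → f ≈ᴾ g → g ≈ᴾ f
    ≈ᴾ-sym (mk≈ᴾ e) = mk≈ᴾ λ μ → sym (e μ)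

    ≈ᴾ-trans : ∀ {f g h : Poly n} → f ≈ᴾ g → g ≈ᴾ h → f ≈ᴾ h
    ≈ᴾ-trans (mk≈ᴾ d) (mk≈ᴾ e) = mk≈ᴾ λ μ → trans (d μ) (e μ)

  polyRing : ℕ → CommutativeRing c ℓ
  polyRing n = record
    { Carrier = Poly n
    ; _≈_ = _≈ᴾ_
    ; _+_ = _+ᴾ_
    ; _*_ = _*ᴾ_
    ; -_  = -ᴾ_
    ; 0#  = 0ᴾ
    ; 1#  = 1ᴾ
    ; isCommutativeRing = record
      { isRing = record
        { +-isAbelianGroup = record
          { isGroup = record
            { isMonoid = record
              { isSemigroup = record
                { isMagma = record
                  { isEquivalence = record { refl = ≈ᴾ-refl ; sym = ≈ᴾ-sym ; trans = ≈ᴾ-trans }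
                  ; ∙-cong = +ᴾ-cong
                  }
                ; assoc = +ᴾ-assoc
                }
              ; identity = (λ f → ≈ᴾ-refl) , +ᴾ-identityʳ
              }
            ; inverse = (λ f → ≈ᴾ-trans (+ᴾ-comm (-ᴾ f) f) (-ᴾ-inverseʳ f)) , -ᴾ-inverseʳ
            ; ⁻¹-cong = -ᴾ-cong
            }
          ; comm = +ᴾ-comm
          }
        ; *-cong = *ᴾ-cong
        ; *-assoc = *ᴾ-assoc
        ; *-identity = *ᴾ-identityˡ , λ f → ≈ᴾ-trans (*ᴾ-comm f 1ᴾ) (*ᴾ-identityˡ f)
        ; distrib = (λ f g h → ≈ᴾ-trans (*ᴾ-comm f (g +ᴾ h))
                      (≈ᴾ-trans (*ᴾ-distribʳ f g h) (+ᴾ-cong (*ᴾ-comm g f) (*ᴾ-comm h f))))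
                  , *ᴾ-distribʳ
        }
      ; *-comm = *ᴾ-comm
      }
    }

  const-cong : ∀ {r s} → r ≈ s → const {n} r ≈ᴾ const s
  const-cong r≈s = ≈ᴾ-by-pairing λ φ → +-congʳ (*-congʳ r≈s)

  const-+ : ∀ r s → const {n} (r + s) ≈ᴾ const r +ᴾ const s
  const-+ r s = ≈ᴾ-by-pairing λ φ → trans (+-congʳ (distribʳ _ _ _)) (+-assoc _ _ _)

  const-* : ∀ r s → const {n} (r * s) ≈ᴾ const r *ᴾ const s
  const-* {n} r s = ≈ᴾ-by-pairing λ φ →
    +-congʳ (*-congˡ (reflexive (≡.cong φ (≡.sym (+ᵐ-identityˡ (replicate n 0))))))

  const-0 : const {n} 0# ≈ᴾ 0ᴾ
  const-0 = ≈ᴾ-by-pairing λ φ → trans (+-identityʳ _) (zeroˡ _)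

  open SemiringOps (RawRing.rawSemiring rawRing) using (_^_; product; sum)
  open Exponentiation commutativeSemiring using (^-homo-*; ^-congˡ; ^-congʳ)
  private module Π = MonoidSum *-commutativeMonoid

  monomialValue : Vector Carrier n → Monomial n → Carrier
  monomialValue s μ = product (λ k → s k ^ lookup μ k)

  monomialValue-+ : ∀ (s : Vector Carrier n) μ ν →
    monomialValue s (μ +ᵐ ν) ≈ monomialValue s μ * monomialValue s ν
  monomialValue-+ s μ ν = trans
    (Π.sum-cong-≋ λ k → trans (^-congʳ (s k) (Vec.lookup-zipWith ℕ._+_ k μ ν))
                              (^-homo-* (s k) (lookup μ k) (lookup ν k)))
    (Π.∑-distrib-+ (λ k → s k ^ lookup μ k) (λ k → s k ^ lookup ν k))

  monomialValue-0 : ∀ (s : Vector Carrier n) → monomialValue s (replicate n 0) ≈ 1#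
  monomialValue-0 {n} s = trans
    (Π.sum-cong-≋ λ k → ^-congʳ (s k) (Vec.lookup-replicate k 0))
    (Π.sum-replicate-zero n)

  monomialValue-var : ∀ (s : Vector Carrier n) k → monomialValue s (replicate n 0 [ k ]≔ 1) ≈ s k
  monomialValue-var s zero    =
    trans (*-cong (*-identityʳ _) (monomialValue-0 (s ∘ suc))) (*-identityʳ _)
  monomialValue-var s (suc k) = trans (*-identityˡ _) (monomialValue-var (s ∘ suc) k)

  eval≈pairing : ∀ (f : Poly n) s → eval f s ≈ pairing f (monomialValue s)
  eval≈pairing []            s = refl
  eval≈pairing ((r , μ) ∷ f) s = +-congˡ (eval≈pairing f s)

  eval-cong : ∀ {f g : Poly n} s → f ≈ᴾ g → eval f s ≈ eval g s
  eval-cong {f = f} {g} s f≈g =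
    trans (eval≈pairing f s) (trans (pairing-respects f≈g _) (sym (eval≈pairing g s)))

  eval-congʳ : ∀ (f : Poly n) {s t} → (∀ k → s k ≈ t k) → eval f s ≈ eval f t
  eval-congʳ []            eq = refl
  eval-congʳ ((r , μ) ∷ f) eq = +-cong
    (*-congˡ (Π.sum-cong-≋ λ k → ^-congˡ (lookup μ k) (eq k))) (eval-congʳ f eq)

  eval-+ : ∀ (f g : Poly n) s → eval (f +ᴾ g) s ≈ eval f s + eval g s
  eval-+ f g s = begin
    eval (f +ᴾ g) s            ≈⟨ eval≈pairing (f +ᴾ g) s ⟩
    pairing (f +ᴾ g) _         ≈⟨ pairing-++ f g _ ⟩
    pairing f _ + pairing g _  ≈⟨ +-cong (eval≈pairing f s) (eval≈pairing g s) ⟨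
    eval f s + eval g s        ∎

  eval-neg : ∀ (f : Poly n) s → eval (-ᴾ f) s ≈ - eval f s
  eval-neg f s = trans (eval≈pairing (-ᴾ f) s)
    (trans (pairing-neg f _) (-‿cong (sym (eval≈pairing f s))))

  eval-- : ∀ (f g : Poly n) s → eval (f -ᴾ g) s ≈ eval f s - eval g s
  eval-- f g s = trans (eval-+ f (-ᴾ g) s) (+-congˡ (eval-neg g s))

  eval-* : ∀ (f g : Poly n) s → eval (f *ᴾ g) s ≈ eval f s * eval g s
  eval-* f g s = begin
    eval (f *ᴾ g) s                                       ≈⟨ eval≈pairing (f *ᴾ g) s ⟩
    pairing (f *ᴾ g) v                                    ≈⟨ pairing-* f g v ⟩
    pairing f (λ μ → pairing g (λ ν → v (μ +ᵐ ν)))        ≈⟨ pairing-cong f (λ μ → inner μ) ⟩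
    pairing f (λ μ → pairing g v * v μ)                   ≈⟨ pairing-scale (pairing g v) f v ⟨
    pairing g v * pairing f v                             ≈⟨ *-comm _ _ ⟩
    pairing f v * pairing g v                             ≈⟨ *-cong (eval≈pairing f s) (eval≈pairing g s) ⟨
    eval f s * eval g s                                   ∎
    where
    v = monomialValue s
    inner : ∀ μ → pairing g (λ ν → v (μ +ᵐ ν)) ≈ pairing g v * v μ
    inner μ = begin
      pairing g (λ ν → v (μ +ᵐ ν))  ≈⟨ pairing-cong g (monomialValue-+ s μ) ⟩
      pairing g (λ ν → v μ * v ν)   ≈⟨ pairing-scale (v μ) g v ⟨
      v μ * pairing g v             ≈⟨ *-comm _ _ ⟩
      pairing g v * v μ             ∎

  eval-const : ∀ r (s : Vector Carrier n) → eval (const r) s ≈ r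
  eval-const r s = trans (+-identityʳ _) (trans (*-congˡ (monomialValue-0 s)) (*-identityʳ r))

  eval-var : ∀ k (s : Vector Carrier n) → eval (var k) s ≈ s k
  eval-var k s = trans (+-identityʳ _) (trans (*-identityˡ _) (monomialValue-var s k))

  eval-^ : ∀ (f : Poly n) k s → eval (f ^ᴾ k) s ≈ eval f s ^ k
  eval-^ f zero    s = eval-const 1# s
  eval-^ f (suc k) s = trans (eval-* f (f ^ᴾ k) s) (*-congˡ (eval-^ f k s))

  eval-sum : ∀ {k} (f : Vector (Poly n) k) s → eval (sumᴾ f) s ≈ sum (λ i → eval (f i) s)
  eval-sum {k = zero}  f s = refl
  eval-sum {k = suc k} f s = trans (eval-+ (f zero) _ s) (+-congˡ (eval-sum (f ∘ suc) s))

  private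
    -- Exponent vectors are sums of unit vectors: the first entry is reached by adding the first
    -- unit vector repeatedly, the other entries by recursion on the vectors that start with 0.
    monomial-induction : ∀ {n p} (P : Monomial n → Set p) → P (replicate n 0) →
      (∀ k → P (replicate n 0 [ k ]≔ 1)) → (∀ {μ ν} → P μ → P ν → P (μ +ᵐ ν)) → ∀ μ → P μ
    monomial-induction {zero}  P P₀ P₁ P₊ []      = P₀
    monomial-induction {suc n} P P₀ P₁ P₊ (e ∷ μ) =
      ≡.subst P (≡.cong₂ _∷_ (ℕ.+-identityʳ e) (+ᵐ-identityˡ μ)) (P₊ (first e) (rest μ))
      where
      first : ∀ e → P (e ∷ replicate n 0)
      first zero    = P₀
      first (suc e) = ≡.subst P (≡.cong (suc e ∷_) (+ᵐ-identityˡ (replicate n 0))) (P₊ (P₁ zero) (first e))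
      rest : ∀ μ → P (0 ∷ μ)
      rest = monomial-induction (P ∘ (0 ∷_)) P₀ (P₁ ∘ suc) P₊

  term : Carrier → Monomial n → Poly n
  term r μ = (r , μ) ∷ []

  -- Constants and variables generate the polynomial ring. Needed for the action on an idempotent,
  -- which is known on the variables and compatible with both operations.
  poly-induction : ∀ {n p} (P : Poly n → Set p) → (∀ {f g} → f ≈ᴾ g → P f → P g) →
    (∀ r → P (const r)) → (∀ k → P (var k)) →
    (∀ {f g} → P f → P g → P (f +ᴾ g)) → (∀ {f g} → P f → P g → P (f *ᴾ g)) → ∀ f → P f
  poly-induction {n} P P≈ Pconst Pvar P+ P* = go
    where
    monic : ∀ μ → P (term 1# μ)
    monic = monomial-induction (P ∘ term 1#) (Pconst 1#) Pvar λ {μ} {ν} Pμ Pν →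
      P≈ (≈ᴾ-by-pairing λ φ → +-congʳ (*-congʳ (*-identityˡ 1#))) (P* {term 1# μ} {term 1# ν} Pμ Pν)
    go : ∀ f → P f
    go []            = P≈ const-0 (Pconst 0#)
    go ((r , μ) ∷ f) = P+ {term r μ} (P≈ (≈ᴾ-by-pairing λ φ → +-congʳ (*-cong (*-identityʳ r)
      (reflexive (≡.cong φ (+ᵐ-identityˡ μ))))) (P* {const r} {term 1# μ} (Pconst r) (monic μ))) (go f)

-- Counting arguments and decidable equality on finite sets

-- If `k` were missed, punching it out would inject n + 1 elements into n.
injective⇒surjective : ∀ {n} (f : Fin n → Fin n) → (∀ {i j} → f i ≡ f j → i ≡ j) →
  ∀ k → ∃ λ i → f i ≡ k
injective⇒surjective {suc n} f f-inj k with Fin.any? (λ i → f i Fin.≟ k)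
... | yes hit = hit
... | no miss = contradiction (Fin.injective⇒≤ avoid-injective) (ℕ.<⇒≱ (ℕ.n<1+n n))
  where
  k≢f : ∀ i → k ≢ f i
  k≢f i k≡fi = miss (i , ≡.sym k≡fi)
  avoid-injective : ∀ {i j} → punchOut (k≢f i) ≡ punchOut (k≢f j) → i ≡ j
  avoid-injective {i} {j} eq = f-inj (Fin.punchOut-injective (k≢f i) (k≢f j) eq)

module Enumerated {c ℓ n} (S : Setoid c ℓ) (cardinality : HasCardinality S n) where
  open Setoid S

  element : Fin n → Carrier
  element = Bijection.to cardinality

  index : Carrier → Fin n
  index x = proj₁ (Bijection.surjective cardinality x)

  element-index : ∀ x → element (index x) ≈ x
  element-index x = proj₂ (Bijection.surjective cardinality x) ≡.refl

  element-injective : ∀ {i j} → element i ≈ element j → i ≡ j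
  element-injective = Bijection.injective cardinality

  -- Surjectivity chooses an index for each representative separately; injectivity of the
  -- enumeration forces the choices for equal elements to agree.
  index-cong : ∀ {x y} → x ≈ y → index x ≡ index y
  index-cong x≈y = element-injective (trans (element-index _) (trans x≈y (sym (element-index _))))

  index-injective : ∀ {x y} → index x ≡ index y → x ≈ y
  index-injective eq = trans (sym (element-index _)) (trans (reflexive (≡.cong element eq)) (element-index _))

  infix 4 _≈?_
  _≈?_ : ∀ x y → Dec (x ≈ y)
  x ≈? y = map′ index-injective index-cong (index x Fin.≟ index y)

-- Phrased with negated equality, which is decidable here, instead of the apartness of a Heyting
-- field; `field-inverse` bridges the two.
HasInverses : ∀ {c ℓ} → CommutativeRing c ℓ → Set (c ⊔ ℓ)
HasInverses R = ∀ x → ¬ (x ≈ 0#) → ∃ λ y → x * y ≈ 1#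
  where open CommutativeRing R

-- Finite fields: cancellation, permutations and Fermat's theorem

module FiniteField {c ℓ} (R : CommutativeRing c ℓ) (m : ℕ) (1<m : 1 < m)
  (cardinality : HasCardinality (CommutativeRing.setoid R) (suc m))
  (invertible : HasInverses R) where
  open CommutativeRing R hiding (zero)
  open RingProperties ring using (-0#≈0#; [y-z]x≈yx-zx)
  open GroupProperties +-group using (x∙y⁻¹≈ε⇒x≈y; x≈y⇒x∙y⁻¹≈ε; identityʳ-unique; inverseʳ-unique; ∙-cancelʳ; //-rightDividesˡ)
  open CommutativeSemigroupProperties *-commutativeSemigroup using (x∙yz≈y∙xz)
  open SemiringOps (RawRing.rawSemiring rawRing) using (_^_; product; sum)
  open Exponentiation commutativeSemiring using (^-congˡ; ^-distrib-*)
  open SemiringSum semiring using (sum-cong-≋; ∑-distrib-+; *-distribˡ-sum; sum-remove; sum-replicate-zero)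
  private module Π = MonoidSum *-commutativeMonoid
  open Distributivity R using (invertible-cancelˡ-zero)
  open SetoidReasoning setoid

  open Enumerated setoid cardinality public

  -- In the zero ring all elements coincide, whereas the indices 0 and 1 enumerate two different
  -- ones.
  1≉0 : ¬ (1# ≈ 0#)
  1≉0 1≈0 = distinct (element-injective (trans (≈0 _) (sym (≈0 _))))
    where
    ≈0 : ∀ x → x ≈ 0#
    ≈0 x = trans (sym (*-identityʳ x)) (trans (*-congˡ 1≈0) (zeroʳ x))
    distinct : ¬ (fromℕ< {0} (s≤s z≤n) ≡ fromℕ< (s≤s (ℕ.≤-trans (s≤s z≤n) 1<m)))
    distinct eq = ℕ.0≢1+n (≡.trans (≡.cong toℕ eq) (Fin.toℕ-fromℕ< (s≤s (ℕ.≤-trans (s≤s z≤n) 1<m))))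

  *-cancelˡ-zero : ∀ {x y} → ¬ (x ≈ 0#) → x * y ≈ 0# → y ≈ 0#
  *-cancelˡ-zero {x} x≉0 = let x⁻¹ , xx⁻¹≈1 = invertible x x≉0 in
    invertible-cancelˡ-zero (trans (*-comm x⁻¹ x) xx⁻¹≈1)

  *-cancelˡ : ∀ {x y z} → ¬ (x ≈ 0#) → x * y ≈ x * z → y ≈ z
  *-cancelˡ {x} {y} {z} x≉0 xy≈xz = x∙y⁻¹≈ε⇒x≈y y z (*-cancelˡ-zero x≉0
    (trans (RingProperties.x[y-z]≈xy-xz ring x y z) (x≈y⇒x∙y⁻¹≈ε xy≈xz)))

  ^-≉0 : ∀ {x} k → ¬ (x ≈ 0#) → ¬ (x ^ k ≈ 0#)
  ^-≉0 zero    x≉0 = 1≉0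
  ^-≉0 (suc k) x≉0 = ^-≉0 k x≉0 ∘ *-cancelˡ-zero x≉0

  product-≉0 : ∀ {n} (t : Vector Carrier n) → (∀ i → ¬ (t i ≈ 0#)) → ¬ (product t ≈ 0#)
  product-≉0 {zero}  t t≉0 = 1≉0
  product-≉0 {suc n} t t≉0 = product-≉0 (t ∘ suc) (t≉0 ∘ suc) ∘ *-cancelˡ-zero (t≉0 zero)

  private
    fieldPermutation : (f : Carrier → Carrier) → (∀ {x y} → f x ≈ f y → x ≈ y) →
      Permutation.Permutation′ (suc m)
    fieldPermutation f f-inj = Permutation.permutation φ (proj₁ ∘ φ-surj) (proj₂ ∘ φ-surj)
        (λ i → φ-inj (proj₂ (φ-surj (φ i))))
      where
      φ = index ∘ f ∘ element
      φ-inj : ∀ {i j} → φ i ≡ φ j → i ≡ j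
      φ-inj = element-injective ∘ f-inj ∘ index-injective
      φ-surj = injective⇒surjective φ φ-inj

  injective⇒onto : (f : Carrier → Carrier) → (∀ {x y} → x ≈ y → f x ≈ f y) →
    (∀ {x y} → f x ≈ f y → x ≈ y) → ∀ y → ∃ λ x → ∀ {z} → z ≈ x → f z ≈ y
  injective⇒onto f f-cong f-inj y =
    element (π Permutation.⟨$⟩ˡ index y) , λ z≈x → trans (f-cong z≈x) (index-injective (Permutation.inverseʳ π))
    where π = fieldPermutation f f-inj

  -- An injective self-map of the field permutes the indices. The monoid is left open because the
  -- argument serves products in `x^m≈1` and sums for the power sums.
  sum-reindex : ∀ {a b} (M : CommutativeMonoid a b) → let module M = CommutativeMonoid M in
    (φ : Carrier → M.Carrier) → (∀ {x y} → x ≈ y → φ x M.≈ φ y) →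
    (f : Carrier → Carrier) → (∀ {x y} → f x ≈ f y → x ≈ y) →
    MonoidSum.sum M (φ ∘ element) M.≈ MonoidSum.sum M (φ ∘ f ∘ element)
  sum-reindex M φ φ-cong f f-inj =
    M.trans (MonoidSum.sum-permute M (φ ∘ element) (fieldPermutation f f-inj))
            (MonoidSum.sum-cong-≋ M {suc m} λ i → φ-cong (element-index (f (element i))))
    where module M = CommutativeMonoid M

  private
    0ᶠ : Fin (suc m)
    0ᶠ = index 0#

    element-punchIn-≉0 : ∀ j → ¬ (element (punchIn 0ᶠ j) ≈ 0#)
    element-punchIn-≉0 j eq = Fin.punchInᵢ≢i 0ᶠ j
      (element-injective (trans eq (sym (element-index 0#))))

  -- Multiplication by x permutes the nonzero elements, so it does not change their product.
  x^m≈1 : ∀ x → ¬ (x ≈ 0#) → x ^ m ≈ 1#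
  x^m≈1 x x≉0 = *-cancelˡ Πu≉0 (begin
    product (u ∘ element) * x ^ m                    ≈⟨ *-congˡ Πw ⟨
    product (u ∘ element) * product (w ∘ element)    ≈⟨ *-comm _ _ ⟩
    product (w ∘ element) * product (u ∘ element)    ≈⟨ Π.∑-distrib-+ (w ∘ element) (u ∘ element) ⟨
    product (λ i → w (element i) * u (element i))    ≈⟨ Π.sum-cong-≋ (λ i → u-x* (element i)) ⟨
    product (λ i → u (x * element i))                ≈⟨ sum-reindex *-commutativeMonoid u u-cong (x *_) (*-cancelˡ x≉0) ⟨
    product (u ∘ element)                            ≈⟨ *-identityʳ _ ⟨
    product (u ∘ element) * 1#                       ∎)
    where
    -- `u` replaces 0 by 1, so its product over the whole field is that of the nonzero elements. `w`
    -- is the factor by which `u` changes under multiplication by `x`: 1 at zero and `x` elsewhere.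
    u w : Carrier → Carrier
    u y with y ≈? 0#
    ... | yes _ = 1#
    ... | no  _ = y
    w y with y ≈? 0#
    ... | yes _ = 1#
    ... | no  _ = x
    u-cong : ∀ {y z} → y ≈ z → u y ≈ u z
    u-cong {y} {z} y≈z with y ≈? 0# | z ≈? 0#
    ... | yes _   | yes _   = refl
    ... | yes y≈0 | no z≉0  = contradiction (trans (sym y≈z) y≈0) z≉0
    ... | no y≉0  | yes z≈0 = contradiction (trans y≈z z≈0) y≉0
    ... | no _    | no _    = y≈z
    u-x* : ∀ y → u (x * y) ≈ w y * u y
    u-x* y with y ≈? 0# | (x * y) ≈? 0#
    ... | yes _   | yes _    = sym (*-identityʳ _)
    ... | yes y≈0 | no xy≉0  = contradiction (trans (*-congˡ y≈0) (zeroʳ x)) xy≉0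
    ... | no y≉0  | yes xy≈0 = contradiction (*-cancelˡ-zero x≉0 xy≈0) y≉0
    ... | no _    | no _     = refl
    u≉0 : ∀ y → ¬ (u y ≈ 0#)
    u≉0 y with y ≈? 0#
    ... | yes _   = 1≉0
    ... | no y≉0  = y≉0
    Πu≉0 : ¬ (product (u ∘ element) ≈ 0#)
    Πu≉0 = product-≉0 (u ∘ element) (λ i → u≉0 (element i))
    w0 : w (element 0ᶠ) ≈ 1#
    w0 with element 0ᶠ ≈? 0#
    ... | yes _ = refl
    ... | no ≉0 = contradiction (element-index 0#) ≉0
    w≉0 : ∀ y → ¬ (y ≈ 0#) → w y ≈ x
    w≉0 y y≉0 with y ≈? 0#
    ... | yes y≈0 = contradiction y≈0 y≉0
    ... | no _    = refl
    Πw : product (w ∘ element) ≈ x ^ m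
    Πw = begin
      product (w ∘ element)                                     ≈⟨ Π.sum-remove {i = 0ᶠ} (w ∘ element) ⟩
      w (element 0ᶠ) * product (removeAt (w ∘ element) 0ᶠ)       ≈⟨ *-cong w0 (Π.sum-cong-≋ λ j → w≉0 _ (element-punchIn-≉0 j)) ⟩
      1# * product (Vector.replicate m x)                              ≈⟨ trans (*-identityˡ _) (Π.sum-replicate m) ⟩
      x ^ m                                                     ∎

  0^m≈0 : 0# ^ m ≈ 0#
  0^m≈0 = positive m 1<m
    where
    positive : ∀ k → 1 < k → 0# ^ k ≈ 0#
    positive (suc k) _ = zeroˡ _

  x^1+m≈x : ∀ x → x ^ suc m ≈ x
  x^1+m≈x x with x ≈? 0#
  ... | yes x≈0 = trans (*-congʳ x≈0) (trans (zeroˡ _) (sym x≈0))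
  ... | no  x≉0 = trans (*-congˡ (x^m≈1 x x≉0)) (*-identityʳ x)

  -- Roots of polynomials in one variable

  evalCoefficients : ∀ {n} → Vector Carrier n → Carrier → Carrier
  evalCoefficients r x = sum λ k → r k * x ^ toℕ k

  horner : ∀ {n} (r : Vector Carrier (suc n)) x →
    evalCoefficients r x ≈ r zero + x * evalCoefficients (r ∘ suc) x
  horner r x = +-cong (*-identityʳ _)
    (trans (sum-cong-≋ λ k → x∙yz≈y∙xz (r (suc k)) x (x ^ toℕ k))
           (sym (*-distribˡ-sum x (λ k → r (suc k) * x ^ toℕ k))))

  private
    -- Coefficients of (r(x) - r(a)) / (x - a).
    syntheticQuotient : ∀ {n} → Vector Carrier (suc n) → Carrier → Vector Carrier n
    syntheticQuotient {suc n} r a zero    = evalCoefficients (r ∘ suc) a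
    syntheticQuotient {suc n} r a (suc k) = syntheticQuotient (r ∘ suc) a k

    -- r(x) - r(a) = (x - a) quotient(x), both sides moved so that no subtraction occurs.
    synthetic-division : ∀ {n} (r : Vector Carrier (suc n)) a x →
      evalCoefficients r x + a * evalCoefficients (syntheticQuotient r a) x ≈
      evalCoefficients r a + x * evalCoefficients (syntheticQuotient r a) x
    synthetic-division {zero}  r a x = +-congˡ (trans (zeroʳ a) (sym (zeroʳ x)))
    synthetic-division {suc n} r a x = begin
      E r x + a * E Q x                         ≈⟨ +-cong (horner r x) (*-congˡ (horner Q x)) ⟩
      r₀ + x * T x + a * (T a + x * S)          ≈⟨ shuffle r₀ x (T x) a (T a) S ⟩
      r₀ + a * T a + x * (T x + a * S)          ≈⟨ +-congˡ (*-congˡ (synthetic-division (r ∘ suc) a x)) ⟩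
      r₀ + a * T a + x * (T a + x * S)          ≈⟨ +-cong (horner r a) (*-congˡ (horner Q x)) ⟨
      E r a + x * E Q x                         ∎
      where
      E : ∀ {n} → Vector Carrier n → Carrier → Carrier
      E = evalCoefficients
      Q = syntheticQuotient r a
      T = E (r ∘ suc)
      S = E (syntheticQuotient (r ∘ suc) a) x
      r₀ = r zero
      open import Algebra.Solver.Ring.NaturalCoefficients.Default commutativeSemiring
      shuffle : ∀ r x t a u s → r + x * t + a * (u + x * s) ≈ r + a * u + x * (t + a * s)
      shuffle = solve 6 (λ r x t a u s →
        (r :+ x :* t :+ a :* (u :+ x :* s)) := (r :+ a :* u :+ x :* (t :+ a :* s))) refl

    -- With zero quotient, r is the constant r(a), which is zero as well. By Horner's rule the
    -- lowest coefficient is r(a) minus a times the lowest coefficient of the quotient.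
    syntheticQuotient≈0 : ∀ {n} (r : Vector Carrier (suc n)) a →
      (∀ k → syntheticQuotient r a k ≈ 0#) → evalCoefficients r a ≈ 0# → ∀ k → r k ≈ 0#
    syntheticQuotient≈0 {zero}  r a _   ra≈0 zero = trans (sym (trans (+-identityʳ _) (*-identityʳ _))) ra≈0
    syntheticQuotient≈0 {suc n} r a Q≈0 ra≈0 zero = begin
      r zero                                       ≈⟨ +-identityʳ _ ⟨
      r zero + 0#                                  ≈⟨ +-congˡ (trans (*-congˡ (Q≈0 zero)) (zeroʳ a)) ⟨
      r zero + a * evalCoefficients (r ∘ suc) a    ≈⟨ horner r a ⟨
      evalCoefficients r a                         ≈⟨ ra≈0 ⟩
      0#                                           ∎
    syntheticQuotient≈0 {suc n} r a Q≈0 ra≈0 (suc k) =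
      syntheticQuotient≈0 (r ∘ suc) a (Q≈0 ∘ suc) (Q≈0 zero) k

  -- n coefficients mean degree below n. After division by x - a₀ the other n - 1 points are still
  -- roots of the quotient, since the nonzero factor a_i - a₀ cancels.
  too-many-roots : ∀ {n} (r : Vector Carrier n) (a : Vector Carrier n) →
    (∀ {i j} → a i ≈ a j → i ≡ j) → (∀ i → evalCoefficients r (a i) ≈ 0#) → ∀ k → r k ≈ 0#
  too-many-roots {suc n} r a a-inj roots = syntheticQuotient≈0 r (a zero)
    (too-many-roots Q (a ∘ suc) (Fin.suc-injective ∘ a-inj) λ i → *-cancelˡ-zero (distinct i) (root i)) (roots zero)
    where
    Q = syntheticQuotient r (a zero)
    distinct : ∀ i → ¬ (a (suc i) - a zero ≈ 0#)
    distinct i eq = contradiction (a-inj (x∙y⁻¹≈ε⇒x≈y _ _ eq)) λ ()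
    root : ∀ i → (a (suc i) - a zero) * evalCoefficients Q (a (suc i)) ≈ 0#
    root i = trans ([y-z]x≈yx-zx _ _ _) (x≈y⇒x∙y⁻¹≈ε (begin
      a (suc i) * e                                  ≈⟨ +-identityˡ _ ⟨
      0# + a (suc i) * e                             ≈⟨ +-congʳ (roots zero) ⟨
      evalCoefficients r (a zero) + a (suc i) * e    ≈⟨ synthetic-division r (a zero) (a (suc i)) ⟨
      evalCoefficients r (a (suc i)) + a zero * e    ≈⟨ +-congʳ (roots (suc i)) ⟩
      0# + a zero * e                                ≈⟨ +-identityˡ _ ⟩
      a zero * e                                     ∎))
      where e = evalCoefficients Q (a (suc i))

  vanishing-coefficients : (r : Vector Carrier (suc m)) → (∀ x → evalCoefficients r x ≈ 0#) → ∀ k → r k ≈ 0#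
  vanishing-coefficients r r≈0 = too-many-roots r element element-injective (λ i → r≈0 (element i))

  sum-zero : ∀ {n} (t : Vector Carrier n) → (∀ i → t i ≈ 0#) → sum t ≈ 0#
  sum-zero {n} t t≈0 = trans (sum-cong-≋ t≈0) (sum-replicate-zero n)

  sum-single : ∀ {n} (t : Vector Carrier n) k → (∀ i → i ≢ k → t i ≈ 0#) → sum t ≈ t k
  sum-single t zero    t≈0 =
    trans (+-congˡ (sum-zero (t ∘ suc) λ i → t≈0 (suc i) λ ())) (+-identityʳ _)
  sum-single t (suc k) t≈0 = trans (+-congʳ (t≈0 zero λ ())) (trans (+-identityˡ _)
    (sum-single (t ∘ suc) k λ i i≢k → t≈0 (suc i) (i≢k ∘ Fin.suc-injective)))

  δ : ∀ {n} → Fin n → Fin n → Carrier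
  δ k i = if does (k Fin.≟ i) then 1# else 0#

  δ-diagonal : ∀ {n} (k : Fin n) → δ k k ≈ 1#
  δ-diagonal k with k Fin.≟ k
  ... | yes _  = refl
  ... | no k≢k = contradiction ≡.refl k≢k

  δ-off-diagonal : ∀ {n} {k i : Fin n} → k ≢ i → δ k i ≈ 0#
  δ-off-diagonal {k = k} {i} k≢i with k Fin.≟ i
  ... | yes k≡i = contradiction k≡i k≢i
  ... | no _    = refl

  sum-δ : ∀ {n} (k : Fin n) (t : Vector Carrier n) → sum (λ i → δ k i * t i) ≈ t k
  sum-δ k t = trans
    (sum-single _ k λ i i≢k → trans (*-congʳ (δ-off-diagonal (i≢k ∘ ≡.sym))) (zeroˡ (t i)))
    (trans (*-congʳ (δ-diagonal k)) (*-identityˡ _))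

  -- Power sums of the field

  powerSum : ℕ → Carrier
  powerSum j = sum λ i → element i ^ j

  -- Translation by 1 permutes the field, so it preserves the sum of all elements, but it also adds
  -- 1 once for every element.
  powerSum-0 : powerSum 0 ≈ 0#
  powerSum-0 = identityʳ-unique (sum element) (powerSum 0) (begin
    sum element + powerSum 0          ≈⟨ ∑-distrib-+ element (λ _ → 1#) ⟨
    sum (λ i → element i + 1#)        ≈⟨ sum-reindex +-commutativeMonoid id id (_+ 1#)
                                           (∙-cancelʳ 1# _ _) ⟨
    sum element                       ∎)

  powerSum-m : powerSum m ≈ - 1#
  powerSum-m = begin
    powerSum m                                            ≈⟨ sum-remove {i = 0ᶠ} (λ i → element i ^ m) ⟩
    element 0ᶠ ^ m + sum (λ j → element (punchIn 0ᶠ j) ^ m)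
      ≈⟨ +-cong (trans (^-congˡ m (element-index 0#)) 0^m≈0)
                (sum-cong-≋ λ j → x^m≈1 _ (element-punchIn-≉0 j)) ⟩
    0# + sum {m} (λ _ → 1#)                               ≈⟨ +-identityˡ _ ⟩
    -- `powerSum 0` unfolds to 1 plus this sum of m ones, and it is zero.
    sum {m} (λ _ → 1#)                                    ≈⟨ inverseʳ-unique 1# _ powerSum-0 ⟩
    - 1#                                                  ∎

  private
    -- Otherwise x^(j+1) - x would have m + 1 roots although j < m.
    non-root : ∀ j → 0 < j → j < m → ∃ λ g → ¬ (g ^ suc j ≈ g)
    non-root j 0<j j<m =
      let i , g≉ = Fin.¬∀⟶∃¬ (suc m) _ (λ i → element i ^ suc j ≈? element i) not-all in element i , g≉
      where
      0<m = ℕ.<-trans (s≤s z≤n) 1<m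
      high low : Fin (suc m)
      high = fromℕ< (s≤s j<m)
      low  = fromℕ< (s≤s 0<m)
      high≢low : high ≢ low
      high≢low eq = ℕ.<⇒≢ 0<j (ℕ.suc-injective (≡.trans (≡.sym (Fin.toℕ-fromℕ< (s≤s 0<m)))
        (≡.trans (≡.cong toℕ (≡.sym eq)) (Fin.toℕ-fromℕ< (s≤s j<m)))))
      eval-δ : ∀ k x → evalCoefficients (δ k) x ≈ x ^ toℕ k
      eval-δ k x = sum-δ k (λ i → x ^ toℕ i)
      difference : Vector Carrier (suc m)
      difference k = δ high k - δ low k
      not-all : ¬ (∀ i → element i ^ suc j ≈ element i)
      not-all all = 1≉0 (begin
        1#             ≈⟨ δ-diagonal low ⟨
        δ low low      ≈⟨ x∙y⁻¹≈ε⇒x≈y _ _ (vanishing-coefficients difference vanish low) ⟨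
        δ high low     ≈⟨ δ-off-diagonal high≢low ⟩
        0#             ∎)
        where
        same : ∀ x → x ^ suc j ≈ x
        same x = trans (^-congˡ (suc j) (sym (element-index x))) (trans (all (index x)) (element-index x))
        vanish : ∀ x → evalCoefficients difference x ≈ 0#
        vanish x = ∙-cancelʳ (evalCoefficients (δ low) x) _ _ (begin
          evalCoefficients difference x + evalCoefficients (δ low) x
            ≈⟨ ∑-distrib-+ (λ k → difference k * x ^ toℕ k) (λ k → δ low k * x ^ toℕ k) ⟨
          sum (λ k → difference k * x ^ toℕ k + δ low k * x ^ toℕ k)
            ≈⟨ sum-cong-≋ {suc m} (λ k → trans (sym (distribʳ (x ^ toℕ k) (difference k) (δ low k)))
                 (*-congʳ (//-rightDividesˡ (δ low k) (δ high k)))) ⟩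
          evalCoefficients (δ high) x
            ≈⟨ trans (eval-δ high x) (reflexive (≡.cong (x ^_) (Fin.toℕ-fromℕ< (s≤s j<m)))) ⟩
          x ^ suc j
            ≈⟨ trans (same x) (sym (*-identityʳ x)) ⟩
          x ^ 1
            ≈⟨ trans (eval-δ low x) (reflexive (≡.cong (x ^_) (Fin.toℕ-fromℕ< (s≤s 0<m)))) ⟨
          evalCoefficients (δ low) x
            ≈⟨ +-identityˡ _ ⟨
          0# + evalCoefficients (δ low) x ∎)

  -- Scaling by g permutes the field and multiplies the power sum by g^j, so a g with g^j different
  -- from 1 forces it to vanish. The condition that g^(j+1) differs from g also excludes g = 0.
  powerSum-< : ∀ j → j < m → powerSum j ≈ 0#
  powerSum-< zero      _   = powerSum-0
  powerSum-< j@(suc _) j<m = *-cancelˡ-zero g^j-1≉0 (begin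
    (g ^ j - 1#) * powerSum j                 ≈⟨ [y-z]x≈yx-zx _ _ _ ⟩
    g ^ j * powerSum j - 1# * powerSum j      ≈⟨ x≈y⇒x∙y⁻¹≈ε (trans scaled (sym (*-identityˡ _))) ⟩
    0#                                        ∎)
    where
    g = proj₁ (non-root j (s≤s z≤n) j<m)
    g^1+j≉g = proj₂ (non-root j (s≤s z≤n) j<m)
    g≉0 : ¬ (g ≈ 0#)
    g≉0 g≈0 = g^1+j≉g (trans (*-congʳ g≈0) (trans (zeroˡ _) (sym g≈0)))
    g^j-1≉0 : ¬ (g ^ j - 1# ≈ 0#)
    g^j-1≉0 eq = g^1+j≉g (trans (*-congˡ (x∙y⁻¹≈ε⇒x≈y _ _ eq)) (*-identityʳ g))
    scaled : g ^ j * powerSum j ≈ powerSum j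
    scaled = begin
      g ^ j * powerSum j                    ≈⟨ *-distribˡ-sum (g ^ j) (λ i → element i ^ j) ⟩
      sum (λ i → g ^ j * element i ^ j)     ≈⟨ sum-cong-≋ (λ i → ^-distrib-* g (element i) j) ⟨
      sum (λ i → (g * element i) ^ j)       ≈⟨ sum-reindex +-commutativeMonoid (_^ j) (^-congˡ j) (g *_) (*-cancelˡ g≉0) ⟨
      powerSum j                            ∎

  -- The value sum of a polynomial only sees the power sum with exponent m.
  sum-of-values : (r : Vector Carrier (suc m)) →
    sum (λ i → evalCoefficients r (element i)) ≈ - r (Fin.fromℕ m)
  sum-of-values r = begin
    sum (λ i → sum λ k → r k * element i ^ toℕ k)   ≈⟨ SemiringSum.∑-comm semiring (λ i k → r k * element i ^ toℕ k) ⟩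
    sum (λ k → sum λ i → r k * element i ^ toℕ k)   ≈⟨ sum-cong-≋ (λ k → *-distribˡ-sum (r k) (λ i → element i ^ toℕ k)) ⟨
    sum (λ k → r k * powerSum (toℕ k))              ≈⟨ SemiringSum.sum-init-last semiring (λ k → r k * powerSum (toℕ k)) ⟩
    sum (λ k → r (Fin.inject₁ k) * powerSum (toℕ (Fin.inject₁ k))) + r (Fin.fromℕ m) * powerSum (toℕ (Fin.fromℕ m))
      ≈⟨ +-cong (sum-zero {m} _ λ k → trans (*-congˡ (lower k)) (zeroʳ _))
                (*-congˡ (trans (reflexive (≡.cong powerSum (Fin.toℕ-fromℕ m))) powerSum-m)) ⟩
    0# + r (Fin.fromℕ m) * - 1#                     ≈⟨ +-identityˡ _ ⟩
    r (Fin.fromℕ m) * - 1#                          ≈⟨ RingProperties.-‿distribʳ-* ring _ _ ⟨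
    - (r (Fin.fromℕ m) * 1#)                        ≈⟨ -‿cong (*-identityʳ _) ⟩
    - r (Fin.fromℕ m)                               ∎
    where
    lower : ∀ (k : Fin m) → powerSum (toℕ (Fin.inject₁ k)) ≈ 0#
    lower k = powerSum-< _ (≡.subst (_< m) (≡.sym (Fin.toℕ-inject₁ k)) (Fin.toℕ<n k))

  permutation⇒top-coefficient≈0 : (r : Vector Carrier (suc m)) →
    (∀ {x y} → evalCoefficients r x ≈ evalCoefficients r y → x ≈ y) → r (Fin.fromℕ m) ≈ 0#
  permutation⇒top-coefficient≈0 r r-inj = begin
    r (Fin.fromℕ m)         ≈⟨ GroupProperties.⁻¹-involutive +-group _ ⟨
    - (- r (Fin.fromℕ m))   ≈⟨ -‿cong (trans (sym (sum-of-values r)) values) ⟩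
    - 0#                    ≈⟨ -0#≈0# ⟩
    0#                      ∎
    where
    values : sum (λ i → evalCoefficients r (element i)) ≈ 0#
    values = begin
      sum (λ i → evalCoefficients r (element i))
        ≈⟨ sum-reindex +-commutativeMonoid id id (evalCoefficients r) r-inj ⟨
      sum element                        ≈⟨ sum-cong-≋ (λ i → *-identityʳ (element i)) ⟨
      -- Here `1 < m` enters. Over the field with two elements the sum of all elements is 1, and x
      -- is a permutation polynomial of degree q - 1.
      powerSum 1                         ≈⟨ powerSum-< 1 1<m ⟩
      0#                                 ∎

-- Ideals and their quotient rings

module QuotientRing {c ℓ} (R : CommutativeRing c ℓ) where
  open Polynomials R
  open Ideals R
  open PolynomialRing R

  -- The ideals of the theorem are sums `_+ᴵ_`, not members of the inductive family `⟨_⟩`; these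
  -- closure properties are what both have in common.
  record IsIdeal {n i} (I : Pred (Poly n) i) : Set (c ⊔ ℓ ⊔ i) where
    field
      0∈ : 0ᴾ ∈ I
      +∈ : ∀ {f h} → f ∈ I → h ∈ I → f +ᴾ h ∈ I
      *∈ : ∀ f {h} → h ∈ I → f *ᴾ h ∈ I
      ≈∈ : ∀ {f h} → f ≈ᴾ h → f ∈ I → h ∈ I

  ⟨⟩-isIdeal : ∀ {a n} {A : Set a} (g : A → Poly n) → IsIdeal ⟨ g ⟩
  ⟨⟩-isIdeal g = record { 0∈ = zero∈ ; +∈ = +-closed ; *∈ = *-closed ; ≈∈ = ≈-closed }

  module _ {n : ℕ} where
    open CommutativeRing (polyRing n) public
      using ()
      renaming ( refl to ≈ᴾ-refl; sym to ≈ᴾ-sym; trans to ≈ᴾ-trans; +-cong to +ᴾ-cong; *-cong to *ᴾ-cong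
               ; +-congˡ to +ᴾ-congˡ; +-congʳ to +ᴾ-congʳ; *-congˡ to *ᴾ-congˡ; *-congʳ to *ᴾ-congʳ)

  +ᴵ-isIdeal : ∀ {n i j} {I : Pred (Poly n) i} {J : Pred (Poly n) j} →
    IsIdeal I → IsIdeal J → IsIdeal (I +ᴵ J)
  +ᴵ-isIdeal {n} isI isJ = record
    { 0∈ = 0ᴾ , 0ᴾ , I.0∈ , J.0∈ , ≈ᴾ-refl
    ; +∈ = λ (g , h , g∈ , h∈ , eq) (g′ , h′ , g′∈ , h′∈ , eq′) →
        _ , _ , I.+∈ g∈ g′∈ , J.+∈ h∈ h′∈ , ≈ᴾ-trans (+ᴾ-cong eq eq′) (interchange g h g′ h′)
    ; *∈ = λ f (g , h , g∈ , h∈ , eq) →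
        _ , _ , I.*∈ f g∈ , J.*∈ f h∈ , ≈ᴾ-trans (*ᴾ-congˡ {x = f} eq) (distribˡ f g h)
    ; ≈∈ = λ f≈f′ (g , h , g∈ , h∈ , eq) → g , h , g∈ , h∈ , ≈ᴾ-trans (≈ᴾ-sym f≈f′) eq
    }
    where
    module I = IsIdeal isI
    module J = IsIdeal isJ
    open CommutativeRing (polyRing n) using (distribˡ; +-commutativeSemigroup)
    open CommutativeSemigroupProperties +-commutativeSemigroup using (interchange)

  +ᴵ-left : ∀ {n i j} {I : Pred (Poly n) i} {J : Pred (Poly n) j} → IsIdeal J →
    ∀ {f} → f ∈ I → f ∈ I +ᴵ J
  +ᴵ-left {n} isJ {f} f∈ = f , 0ᴾ , f∈ , IsIdeal.0∈ isJ , ≈ᴾ-sym (CommutativeRing.+-identityʳ (polyRing n) f)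

  +ᴵ-right : ∀ {n i j} {I : Pred (Poly n) i} {J : Pred (Poly n) j} → IsIdeal I →
    ∀ {f} → f ∈ J → f ∈ I +ᴵ J
  +ᴵ-right {n} isI {f} f∈ = 0ᴾ , f , IsIdeal.0∈ isI , f∈ , ≈ᴾ-refl

  module _ {n i} {I : Pred (Poly n) i} (ideal : IsIdeal I) where
    open IsIdeal ideal
    open CommutativeRing (polyRing n) hiding (refl; sym; trans)
    open RingProperties ring using (-1*x≈-x; -‿+-comm; x[y-z]≈xy-xz)
    open GroupProperties +-group using (⁻¹-anti-homo-//; x≈y⇒x∙y⁻¹≈ε)
    open CommutativeSemigroupProperties +-commutativeSemigroup using (interchange)
    open SetoidReasoning setoid

    infix 4 _~_
    -- The equality of `Quotient I`, wrapped in a record so that f and g can be inferred from its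
    -- type.
    record _~_ (f g : Poly n) : Set i where
      constructor mk~
      field
        difference∈ : f -ᴾ g ∈ I

    open _~_ public

    ≈ᴾ⇒~ : ∀ {f g} → f ≈ᴾ g → f ~ g
    ≈ᴾ⇒~ f≈g = mk~ (≈∈ (≈ᴾ-sym (x≈y⇒x∙y⁻¹≈ε f≈g)) 0∈)

    private
      -∈ : ∀ {f} → f ∈ I → -ᴾ f ∈ I
      -∈ {f} f∈ = ≈∈ (-1*x≈-x f) (*∈ (-ᴾ 1ᴾ) f∈)

      ~-sym : ∀ {f g} → f ~ g → g ~ f
      ~-sym {f} {g} (mk~ d) = mk~ (≈∈ (⁻¹-anti-homo-// f g) (-∈ d))

      telescope : ∀ f g h → (f -ᴾ g) +ᴾ (g -ᴾ h) ≈ᴾ f -ᴾ h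
      telescope f g h = begin
        (f -ᴾ g) +ᴾ (g -ᴾ h)       ≈⟨ +-assoc f (-ᴾ g) (g -ᴾ h) ⟩
        f +ᴾ (-ᴾ g +ᴾ (g -ᴾ h))    ≈⟨ +-congˡ {x = f} (+-assoc (-ᴾ g) g (-ᴾ h)) ⟨
        f +ᴾ (-ᴾ g +ᴾ g -ᴾ h)      ≈⟨ +-congˡ {x = f} (+-congʳ {x = -ᴾ h} (-‿inverseˡ g)) ⟩
        f -ᴾ h                     ∎

      ~-trans : ∀ {f g h} → f ~ g → g ~ h → f ~ h
      ~-trans {f} {g} {h} (mk~ d) (mk~ e) = mk~ (≈∈ (telescope f g h) (+∈ d e))

      ~-+-cong : ∀ {f f′ g g′} → f ~ f′ → g ~ g′ → f +ᴾ g ~ f′ +ᴾ g′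
      ~-+-cong {f} {f′} {g} {g′} (mk~ d) (mk~ e) = mk~ (≈∈ (begin
        (f -ᴾ f′) +ᴾ (g -ᴾ g′)             ≈⟨ interchange f (-ᴾ f′) g (-ᴾ g′) ⟩
        (f +ᴾ g) +ᴾ (-ᴾ f′ +ᴾ (-ᴾ g′))     ≈⟨ +-congˡ {x = f +ᴾ g} (-‿+-comm f′ g′) ⟩
        (f +ᴾ g) -ᴾ (f′ +ᴾ g′)             ∎) (+∈ d e))

      ~-*-cong : ∀ {f f′ g g′} → f ~ f′ → g ~ g′ → f *ᴾ g ~ f′ *ᴾ g′
      ~-*-cong {f} {f′} {g} {g′} (mk~ d) (mk~ e) = ~-trans
        -- Passes through f′ g: the difference of the products is g (f - f′) + f′ (g - g′).
        (mk~ (≈∈ (≈ᴾ-trans (x[y-z]≈xy-xz g f f′) (+-cong (*-comm g f) (-‿cong (*-comm g f′)))) (*∈ g d)))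
        (mk~ (≈∈ (x[y-z]≈xy-xz f′ g g′) (*∈ f′ e)))

      ~-neg-cong : ∀ {f f′} → f ~ f′ → -ᴾ f ~ -ᴾ f′
      ~-neg-cong {f} {f′} (mk~ d) = mk~ (≈∈ (≈ᴾ-sym (-‿+-comm f (-ᴾ f′))) (-∈ d))

    quotientRing : CommutativeRing c i
    quotientRing = record
      { Carrier = Poly n
      ; _≈_ = _~_
      ; _+_ = _+ᴾ_
      ; _*_ = _*ᴾ_
      ; -_  = -ᴾ_
      ; 0#  = 0ᴾ
      ; 1#  = 1ᴾ
      ; isCommutativeRing = record
        { isRing = record
          { +-isAbelianGroup = record
            { isGroup = record
              { isMonoid = record
                { isSemigroup = record
                  { isMagma = record
                    { isEquivalence = record { refl = ≈ᴾ⇒~ ≈ᴾ-refl ; sym = ~-sym ; trans = ~-trans }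
                    ; ∙-cong = ~-+-cong
                    }
                  ; assoc = λ f g h → ≈ᴾ⇒~ (+-assoc f g h)
                  }
                ; identity = (λ f → ≈ᴾ⇒~ (+-identityˡ f)) , (λ f → ≈ᴾ⇒~ (+-identityʳ f))
                }
              ; inverse = (λ f → ≈ᴾ⇒~ (-‿inverseˡ f)) , (λ f → ≈ᴾ⇒~ (-‿inverseʳ f))
              ; ⁻¹-cong = ~-neg-cong
              }
            ; comm = λ f g → ≈ᴾ⇒~ (+-comm f g)
            }
          ; *-cong = ~-*-cong
          ; *-assoc = λ f g h → ≈ᴾ⇒~ (*-assoc f g h)
          ; *-identity = (λ f → ≈ᴾ⇒~ (*-identityˡ f)) , (λ f → ≈ᴾ⇒~ (*-identityʳ f))
          ; distrib = (λ f g h → ≈ᴾ⇒~ (distribˡ f g h)) , (λ f g h → ≈ᴾ⇒~ (distribʳ f g h))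
          }
        ; *-comm = λ f g → ≈ᴾ⇒~ (*-comm f g)
        }
      }

    ~0⇒∈ : ∀ {f} → f ~ 0ᴾ → f ∈ I
    ~0⇒∈ {f} (mk~ d) = ≈∈ (+-identityʳ f) d

    ∈⇒~0 : ∀ {f} → f ∈ I → f ~ 0ᴾ
    ∈⇒~0 {f} f∈ = mk~ (≈∈ (≈ᴾ-sym (+-identityʳ f)) f∈)

-- Lagrange interpolation in a commutative algebra over the field

IsHomomorphism : ∀ {c ℓ d e} (R : CommutativeRing c ℓ) (Q : CommutativeRing d e) →
  (CommutativeRing.Carrier R → CommutativeRing.Carrier Q) → Set _
IsHomomorphism R Q = SemiringMorphisms.IsSemiringHomomorphism
  (RawRing.rawSemiring (CommutativeRing.rawRing R)) (RawRing.rawSemiring (CommutativeRing.rawRing Q))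

module Interpolation {c ℓ} (R : CommutativeRing c ℓ) (m : ℕ) (1<m : 1 < m)
  (cardinality : HasCardinality (CommutativeRing.setoid R) (suc m))
  (invertible : HasInverses R)
  {d e} (Q : CommutativeRing d e) {ι : CommutativeRing.Carrier R → CommutativeRing.Carrier Q}
  (homomorphism : IsHomomorphism R Q ι) where
  private
    module R where
      open CommutativeRing R public
      open SemiringOps (RawRing.rawSemiring rawRing) public using (_^_; product; sum)
  open CommutativeRing Q hiding (zero)
  open SemiringOps (RawRing.rawSemiring rawRing) using (_^_; product; sum)
  open SemiringSum semiring using (sum-cong-≋; ∑-distrib-+; *-distribˡ-sum; sum-replicate-zero)
  open SemiringMorphisms.IsSemiringHomomorphism homomorphism using ()
    renaming (⟦⟧-cong to ι-cong; +-homo to ι-+; *-homo to ι-*; 0#-homo to ι-0; 1#-homo to ι-1)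
  open FiniteField R m 1<m cardinality invertible
    using (element; powerSum; powerSum-0; powerSum-m; powerSum-<; x^1+m≈x)
  open Distributivity Q
  open RingProperties ring using (x[y-z]≈xy-xz)
  open GroupProperties +-group using (∙-cancelʳ; //-rightDividesˡ)
  open import Algebra.Solver.Ring.NaturalCoefficients.Default commutativeSemiring
    using (solve; _:=_; _:+_; _:*_)
  open SetoidReasoning setoid

  ι-sum : ∀ {n} (r : Vector R.Carrier n) → ι (R.sum r) ≈ sum (ι ∘ r)
  ι-sum {zero}  r = ι-0
  ι-sum {suc n} r = trans (ι-+ _ _) (+-congˡ (ι-sum (r ∘ suc)))

  -- (X^k - a^k) / (X - a)
  geometric : ℕ → R.Carrier → Carrier → Carrier
  geometric zero    a X = 0#
  geometric (suc k) a X = ι (a R.^ k) + X * geometric k a X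

  -- Lagrange's idempotent at a: 1 - (X - a)^m, expanded.
  idempotent : R.Carrier → Carrier → Carrier
  idempotent a X = ι (R.1# R.- a R.^ m) - X * geometric m a X

  -- This is (X - a) times the geometric sum, arranged without subtraction so that it is an identity
  -- of commutative semirings.
  geometric-telescopes : ∀ k a X →
    X * geometric k a X + ι (a R.^ k) ≈ ι a * geometric k a X + X ^ k
  geometric-telescopes zero    a X = +-cong (trans (zeroʳ X) (sym (zeroʳ _))) ι-1
  geometric-telescopes (suc k) a X = begin
    X * (P + X * H) + ι (a R.^ suc k)   ≈⟨ +-cong (*-congˡ (+-comm P (X * H))) (ι-* a (a R.^ k)) ⟩
    X * (X * H + P) + A * P             ≈⟨ +-congʳ (*-congˡ (geometric-telescopes k a X)) ⟩
    X * (A * H + X ^ k) + A * P         ≈⟨ solve 5 (λ X A H Y P →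
                                             X :* (A :* H :+ Y) :+ A :* P := A :* (P :+ X :* H) :+ X :* Y)
                                             refl X A H (X ^ k) P ⟩
    A * (P + X * H) + X * X ^ k         ∎
    where
    A = ι a
    P = ι (a R.^ k)
    H = geometric k a X

  -- Write the idempotent as C - X H. Modulo X^q = X the product X C cancels against part of X² H,
  -- which leaves -a X H; and this is a (C - X H), because a C = 0.
  X*idempotent : ∀ a X → X ^ suc m ≈ X → X * idempotent a X ≈ ι a * idempotent a X
  X*idempotent a X X^q≈X = begin
    X * (C - X * H)                       ≈⟨ x[y-z]≈xy-xz X C (X * H) ⟩
    X * C - X * (X * H)                   ≈⟨ +-congˡ (-‿cong XXH) ⟩
    X * C - (A * (X * H) + X * C)         ≈⟨ +-congˡ (-‿cong (+-comm (A * (X * H)) (X * C))) ⟩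
    X * C - (X * C + A * (X * H))         ≈⟨ +-congˡ (RingProperties.-‿+-comm ring (X * C) (A * (X * H))) ⟨
    X * C + (- (X * C) - A * (X * H))     ≈⟨ +-assoc _ _ _ ⟨
    X * C - X * C - A * (X * H)           ≈⟨ +-congʳ (trans (-‿inverseʳ _) (sym AC)) ⟩
    A * C - A * (X * H)                   ≈⟨ x[y-z]≈xy-xz A C (X * H) ⟨
    A * (C - X * H)                       ∎
    where
    A = ι a
    C = ι (R.1# R.- a R.^ m)
    P = ι (a R.^ m)
    H = geometric m a X
    C+P : C + P ≈ 1#
    C+P = begin
      C + P                                    ≈⟨ ι-+ _ _ ⟨
      ι (R.1# R.- a R.^ m R.+ a R.^ m)         ≈⟨ ι-cong (GroupProperties.//-rightDividesˡ R.+-group (a R.^ m) R.1#) ⟩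
      ι R.1#                                   ≈⟨ ι-1 ⟩
      1#                                       ∎
    -- C is the indicator of a = 0; the computation is a - a^q = 0.
    AC : A * C ≈ 0#
    AC = begin
      A * C                                    ≈⟨ ι-* _ _ ⟨
      ι (a R.* (R.1# R.- a R.^ m))             ≈⟨ ι-cong (R.trans (RingProperties.x[y-z]≈xy-xz R.ring a R.1# (a R.^ m))
                                                    (GroupProperties.x≈y⇒x∙y⁻¹≈ε R.+-group (R.trans (R.*-identityʳ a) (R.sym (x^1+m≈x a))))) ⟩
      ι R.0#                                   ≈⟨ ι-0 ⟩
      0#                                       ∎
    -- The telescoped identity times X, with X^q replaced by X = X (C + P).
    XXH : X * (X * H) ≈ A * (X * H) + X * C
    XXH = ∙-cancelʳ (X * P) _ _ (begin
      X * (X * H) + X * P                      ≈⟨ distribˡ X (X * H) P ⟨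
      X * (X * H + P)                          ≈⟨ *-congˡ (geometric-telescopes m a X) ⟩
      X * (A * H + X ^ m)                      ≈⟨ distribˡ X (A * H) (X ^ m) ⟩
      X * (A * H) + X ^ suc m                  ≈⟨ +-cong (CommutativeSemigroupProperties.x∙yz≈y∙xz *-commutativeSemigroup X A H)
                                                    (trans X^q≈X (sym (trans (*-congˡ C+P) (*-identityʳ X)))) ⟩
      A * (X * H) + X * (C + P)                ≈⟨ +-congˡ (distribˡ X C P) ⟩
      A * (X * H) + (X * C + X * P)            ≈⟨ +-assoc _ _ _ ⟨
      A * (X * H) + X * C + X * P              ∎)

  -- After summation over a, the coefficients of the powers of X are power sums with exponents below
  -- `m`.
  sum-geometric : ∀ k X → k ℕ.≤ m → sum (λ i → geometric k (element i) X) ≈ 0#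
  sum-geometric zero    X _   = sum-replicate-zero (suc m)
  sum-geometric (suc k) X k<m = begin
    sum (λ i → ι (element i R.^ k) + X * geometric k (element i) X)
      ≈⟨ ∑-distrib-+ (λ i → ι (element i R.^ k)) (λ i → X * geometric k (element i) X) ⟩
    sum (λ i → ι (element i R.^ k)) + sum (λ i → X * geometric k (element i) X)
      ≈⟨ +-cong (ι-sum (λ i → element i R.^ k)) (*-distribˡ-sum X (λ i → geometric k (element i) X)) ⟨
    ι (powerSum k) + X * sum (λ i → geometric k (element i) X)
      ≈⟨ +-cong (trans (ι-cong (powerSum-< k k<m)) ι-0)
                (trans (*-congˡ (sum-geometric k X (ℕ.<⇒≤ k<m))) (zeroʳ X)) ⟩
    0# + 0#  ≈⟨ +-identityˡ 0# ⟩
    0#       ∎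

  -- Only the constant terms survive the summation over a, and they add up to `powerSum 0` minus
  -- `powerSum m`, that is, 0 - (-1).
  sum-idempotent : ∀ X → sum (λ i → idempotent (element i) X) ≈ 1#
  sum-idempotent X = begin
    sum (λ i → idempotent (element i) X)
      ≈⟨ +-identityʳ _ ⟨
    sum (λ i → idempotent (element i) X) + 0#
      ≈⟨ +-congˡ (trans (sym (*-distribˡ-sum X (λ i → H i))) (trans (*-congˡ (sum-geometric m X ℕ.≤-refl)) (zeroʳ X))) ⟨
    sum (λ i → idempotent (element i) X) + sum (λ i → X * H i)
      ≈⟨ ∑-distrib-+ (λ i → idempotent (element i) X) (λ i → X * H i) ⟨
    sum (λ i → C i - X * H i + X * H i)
      ≈⟨ sum-cong-≋ {suc m} (λ i → //-rightDividesˡ (X * H i) (C i)) ⟩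
    sum C
      ≈⟨ ι-sum (λ i → R.1# R.- element i R.^ m) ⟨
    ι (R.sum λ i → R.1# R.- element i R.^ m)
      ≈⟨ ι-cong constants ⟩
    ι R.1#
      ≈⟨ ι-1 ⟩
    1# ∎
    where
    H C : Vector Carrier (suc m)
    H i = geometric m (element i) X
    C i = ι (R.1# R.- element i R.^ m)
    module RS = SemiringSum R.semiring
    constants : R.sum (λ i → R.1# R.- element i R.^ m) R.≈ R.1#
    constants = GroupProperties.∙-cancelʳ R.+-group (powerSum m) _ _
      (R.trans (R.sym (RS.∑-distrib-+ (λ i → R.1# R.- element i R.^ m) (λ i → element i R.^ m)))
      (R.trans (RS.sum-cong-≋ {suc m} λ i → GroupProperties.//-rightDividesˡ R.+-group (element i R.^ m) R.1#)
      (R.trans powerSum-0 (R.sym (R.trans (R.+-congˡ powerSum-m) (R.-‿inverseʳ _))))))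

  module _ {n} (X : Vector Carrier n) (X^q≈X : ∀ k → X k ^ suc m ≈ X k) where

    pointIdempotent : Vector R.Carrier n → Carrier
    pointIdempotent s = product λ k → idempotent (s k) (X k)

    X*pointIdempotent : ∀ s k → X k * pointIdempotent s ≈ ι (s k) * pointIdempotent s
    X*pointIdempotent s k =
      *-product-cong (λ k → idempotent (s k) (X k)) k (X*idempotent (s k) (X k) (X^q≈X k))

    sum-pointIdempotent :
      sum (λ p → pointIdempotent (element ∘ finToFun {suc m} {n} p)) ≈ 1#
    sum-pointIdempotent = begin
      sum (λ p → pointIdempotent (element ∘ finToFun {suc m} {n} p))
        ≈⟨ product-sum (suc m) n (λ k i → idempotent (element i) (X k)) ⟩
      product (λ k → sum λ i → idempotent (element i) (X k))
        ≈⟨ MonoidSum.sum-cong-≋ *-commutativeMonoid {n} (λ k → sum-idempotent (X k)) ⟩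
      product {n} (λ _ → 1#)
        ≈⟨ MonoidSum.sum-replicate-zero *-commutativeMonoid n ⟩
      1# ∎

-- Ideals containing the field equations

module Nullstellensatz {c ℓ} (R : CommutativeRing c ℓ) (m : ℕ) (1<m : 1 < m)
  (cardinality : HasCardinality (CommutativeRing.setoid R) (suc m))
  (invertible : HasInverses R) where
  open CommutativeRing R hiding (zero)
  open SemiringOps (RawRing.rawSemiring rawRing) using (_^_; sum)
  open RingProperties ring using ([y-z]x≈yx-zx)
  open GroupProperties +-group using (x∙y⁻¹≈ε⇒x≈y; x≈y⇒x∙y⁻¹≈ε)
  open Polynomials R
  open Ideals R
  open LinearAlgebra R
  open PermutationIdeals R (suc m) using (fieldEquation)
  open PolynomialRing R
  open QuotientRing R
  open FiniteField R m 1<m cardinality invertible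

  VanishesAt : ∀ {n i} → Pred (Poly n) i → Vector Carrier n → Set (c ⊔ ℓ ⊔ i)
  VanishesAt I s = ∀ f → f ∈ I → eval f s ≈ 0#

  -- The positive form of not being a zero: it provides the value that must be inverted to kill the
  -- idempotent of the point.
  SeparatedFrom : ∀ {n i} → Pred (Poly n) i → Vector Carrier n → Set (c ⊔ ℓ ⊔ i)
  SeparatedFrom I s = ∃ λ f → f ∈ I × ¬ (eval f s ≈ 0#)

  module _ {n i} {I : Pred (Poly n) i} (ideal : IsIdeal I)
    (fieldEquation∈ : ∀ k → fieldEquation k ∈ I)
    (classify : ∀ s → VanishesAt I s ⊎ SeparatedFrom I s) where

    private
      Q : CommutativeRing c i
      Q = quotientRing ideal
      module Q where
        open CommutativeRing Q public
        open SemiringSum (CommutativeRing.semiring Q) public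
        open SemiringOps (RawRing.rawSemiring (CommutativeRing.rawRing Q)) public using (_^_)
      _≃_ : Poly n → Poly n → Set i
      _≃_ = _~_ ideal
      infix 4 _≃_

      const-homomorphism : IsHomomorphism R Q const
      const-homomorphism = record
        { isNearSemiringHomomorphism = record
          { +-isMonoidHomomorphism = record
            { isMagmaHomomorphism = record
              { isRelHomomorphism = record { cong = λ r≈s → ≈ᴾ⇒~ ideal (const-cong r≈s) }
              ; homo = λ r s → ≈ᴾ⇒~ ideal (const-+ r s)
              }
            ; ε-homo = ≈ᴾ⇒~ ideal const-0
            }
          ; *-homo = λ r s → ≈ᴾ⇒~ ideal (const-* r s)
          }
        ; 1#-homo = Q.refl
        }

      open Interpolation R m 1<m cardinality invertible Q const-homomorphism

      -- Powers are stuck on the raw ring, whose equality differs between Q and the polynomial ring.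
      ^-agrees : ∀ f e → f Q.^ e ≡ f ^ᴾ e
      ^-agrees f zero    = ≡.refl
      ^-agrees f (suc e) = ≡.cong (f *ᴾ_) (^-agrees f e)

      var^q≃var : ∀ k → var k Q.^ suc m ≃ var k
      var^q≃var k = ≡.subst (_≃ var k) (≡.sym (^-agrees (var k) (suc m))) (mk~ (fieldEquation∈ k))

      -- The quotient ring has polynomials as elements and the same operations, so this is an actual
      -- polynomial that can be evaluated at points.
      E : Vector Carrier n → Poly n
      E = pointIdempotent var var^q≃var

      #points : ℕ
      #points = suc m ℕ.^ n

      point : Fin #points → Vector Carrier n
      point p = element ∘ finToFun {suc m} {n} p

      point-onto : ∀ s → ∃ λ p → ∀ k → s k ≈ point p k
      point-onto s = p , λ k → trans (sym (element-index (s k)))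
        (reflexive (≡.cong element (≡.sym (Fin.finToFun-funToFin (index ∘ s) k))))
        where p = funToFin (index ∘ s)

      point-injective : ∀ {p p′} → (∀ k → point p k ≈ point p′ k) → p ≡ p′
      point-injective {p} {p′} eq = finToFun-injective {suc m} {n} p p′ (element-injective ∘ eq)

      point-separated : ∀ {p p′} → p ≢ p′ → ∃ λ k → ¬ (point p k ≈ point p′ k)
      point-separated p≢p′ = Fin.¬∀⟶∃¬ n _ (λ k → _ ≈? _) (p≢p′ ∘ point-injective)

      E-absorbs : ∀ s f → f *ᴾ E s ≃ const (eval f s) *ᴾ E s
      E-absorbs s = poly-induction (λ f → f *ᴾ E s ≃ const (eval f s) *ᴾ E s)
        (λ {f} {g} f≈g f-abs → Q.trans (Q.*-congʳ {E s} (≈ᴾ⇒~ ideal (≈ᴾ-sym f≈g)))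
          (Q.trans f-abs (scalar (eval-cong s f≈g))))
        (λ r → scalar (sym (eval-const r s)))
        (λ k → Q.trans (X*pointIdempotent var var^q≃var s k) (scalar (sym (eval-var k s))))
        (λ {f} {g} f-abs g-abs → Q.trans (Distributivity.absorb-+ Q {f} {g} {const (eval f s)} {const (eval g s)} f-abs g-abs)
          (Q.*-congʳ {E s} (Q.trans (≈ᴾ⇒~ ideal (≈ᴾ-sym (const-+ _ _)))
            (≈ᴾ⇒~ ideal (const-cong (sym (eval-+ f g s)))))))
        (λ {f} {g} f-abs g-abs → Q.trans (Distributivity.absorb-* Q {f} {g} {const (eval f s)} {const (eval g s)} f-abs g-abs)
          (Q.*-congʳ {E s} (Q.trans (≈ᴾ⇒~ ideal (≈ᴾ-sym (const-* _ _)))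
            (≈ᴾ⇒~ ideal (const-cong (sym (eval-* f g s)))))))
        where
        scalar : ∀ {r r′} → r ≈ r′ → const r *ᴾ E s ≃ const r′ *ᴾ E s
        scalar r≈r′ = Q.*-congʳ {E s} (≈ᴾ⇒~ ideal (const-cong r≈r′))

      sum-E : sumᴾ (E ∘ point) ≃ 1ᴾ
      sum-E = sum-pointIdempotent var var^q≃var

      vanishes? : Decidable (VanishesAt I ∘ point)
      vanishes? p with classify (point p)
      ... | inj₁ v            = yes v
      ... | inj₂ (f , f∈ , ≉0) = no λ v → ≉0 (v f f∈)

      E-outside : ∀ p → ¬ VanishesAt I (point p) → E (point p) ≃ 0ᴾ
      E-outside p ¬v with classify (point p)
      ... | inj₁ v             = contradiction v ¬v
      ... | inj₂ (f , f∈ , ≉0) =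
        let y , xy≈1 = invertible (eval f (point p)) ≉0 in
        Distributivity.invertible-cancelˡ-zero Q {const (eval f (point p))} {E (point p)} {const y}
          (Q.trans (≈ᴾ⇒~ ideal (≈ᴾ-sym (const-* y _)))
            (≈ᴾ⇒~ ideal (const-cong (trans (*-comm _ _) xy≈1))))
          (Q.trans (Q.sym (E-absorbs (point p) f))
            (Q.trans (Q.*-congʳ {E (point p)} (∈⇒~0 ideal f∈)) (Q.zeroˡ (E (point p)))))

      module S = Selection (select {a = c} {b = i} vanishes?)

    zeroCount : ℕ
    zeroCount = S.size

    private
      zero-point : Fin zeroCount → Vector Carrier n
      zero-point = point ∘ S.pick

      basis : Vector (Poly n) zeroCount
      basis = E ∘ zero-point

      interpolate : ∀ f → f ≃ sumᴾ (λ j → const (eval f (zero-point j)) *ᴾ basis j)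
      interpolate f = begin
        f                                                              ≈⟨ Q.*-identityʳ f ⟨
        f *ᴾ 1ᴾ                                                        ≈⟨ Q.*-congˡ {f} sum-E ⟨
        f *ᴾ sumᴾ (E ∘ point)                                          ≈⟨ Q.*-distribˡ-sum f (E ∘ point) ⟩
        sumᴾ (λ p → f *ᴾ E (point p))                                  ≈⟨ Q.sum-cong-≋ {#points} (λ p → E-absorbs (point p) f) ⟩
        sumᴾ (λ p → const (eval f (point p)) *ᴾ E (point p))
          ≈⟨ S.sum-pick Q.+-commutativeMonoid (λ p → const (eval f (point p)) *ᴾ E (point p))
               (λ {p} ¬v → Q.trans (Q.*-congˡ {const (eval f (point p))} (E-outside p ¬v)) (Q.zeroʳ (const (eval f (point p))))) ⟩
        sumᴾ (λ j → const (eval f (zero-point j)) *ᴾ basis j)          ∎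
        where open SetoidReasoning Q.setoid

      -- Evaluation descends to the quotient exactly because the point is a zero: the difference f -
      -- g lies in I.
      eval-≃ : ∀ {f g} s → VanishesAt I s → f ≃ g → eval f s ≈ eval g s
      eval-≃ {f} {g} s v (mk~ d) = x∙y⁻¹≈ε⇒x≈y _ _ (trans (sym (eval-- f g s)) (v _ d))

      -- Instead of expanding the product, evaluate the congruence x_k E_s = s_k E_s at the zero t,
      -- for a coordinate k in which s and t differ: the factor t_k - s_k cancels.
      eval-E-off-diagonal : ∀ {p p′} → VanishesAt I (point p) → p′ ≢ p → eval (E (point p′)) (point p) ≈ 0#
      eval-E-off-diagonal {p} {p′} v p′≢p =
        let k , ≉ = point-separated {p} {p′} (p′≢p ∘ ≡.sym)
            t = point p k
            s = point p′ k
            e = eval (E (point p′)) (point p)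
        in *-cancelˡ-zero {t - s} (≉ ∘ x∙y⁻¹≈ε⇒x≈y _ _) (begin
          (t - s) * e          ≈⟨ [y-z]x≈yx-zx e t s ⟩
          t * e - s * e        ≈⟨ x≈y⇒x∙y⁻¹≈ε (begin
            t * e                                       ≈⟨ *-congʳ (eval-var k (point p)) ⟨
            eval (var k) (point p) * e                  ≈⟨ eval-* (var k) (E (point p′)) (point p) ⟨
            eval (var k *ᴾ E (point p′)) (point p)      ≈⟨ eval-≃ (point p) v (X*pointIdempotent var var^q≃var (point p′) k) ⟩
            eval (const s *ᴾ E (point p′)) (point p)    ≈⟨ eval-* (const s) (E (point p′)) (point p) ⟩
            eval (const s) (point p) * e                ≈⟨ *-congʳ (eval-const s (point p)) ⟩
            s * e                                       ∎) ⟩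
          0#                   ∎)
        where open SetoidReasoning setoid

      -- Evaluate at this zero that all idempotents sum to 1; every other summand vanishes there.
      eval-E-diagonal : ∀ {p} → VanishesAt I (point p) → eval (E (point p)) (point p) ≈ 1#
      eval-E-diagonal {p} v = begin
        eval (E (point p)) (point p)                    ≈⟨ sum-single (λ p′ → eval (E (point p′)) (point p)) p
                                                             (λ p′ → eval-E-off-diagonal v) ⟨
        sum (λ p′ → eval (E (point p′)) (point p))      ≈⟨ eval-sum (E ∘ point) (point p) ⟨
        eval (sumᴾ (E ∘ point)) (point p)               ≈⟨ eval-≃ (point p) v sum-E ⟩
        eval 1ᴾ (point p)                               ≈⟨ eval-const 1# (point p) ⟩
        1#                                              ∎
        where open SetoidReasoning setoid

    hasDimension : HasDimension (Quotient I) zeroCount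
    hasDimension = basis , spanning , independent
      where
      spanning : Spanning (Quotient I) basis
      spanning f = (λ j → eval f (zero-point j)) , difference∈ (interpolate f)
      -- Evaluating the relation at the k-th zero isolates its k-th coefficient.
      independent : Independent (Quotient I) basis
      independent r d k = begin
        r k                                                             ≈⟨ *-identityʳ (r k) ⟨
        r k * 1#                                                        ≈⟨ *-congˡ (eval-E-diagonal v) ⟨
        r k * eval (basis k) t                                          ≈⟨ sum-single (λ j → r j * eval (basis j) t) k
                                                                             (λ j j≢k → trans (*-congˡ (eval-E-off-diagonal v (j≢k ∘ S.distinct))) (zeroʳ (r j))) ⟨
        sum (λ j → r j * eval (basis j) t)                              ≈⟨ SemiringSum.sum-cong-≋ semiring {zeroCount} (λ j →
                                                                             trans (eval-* (const (r j)) (basis j) t) (*-congʳ (eval-const (r j) t))) ⟨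
        sum (λ j → eval (const (r j) *ᴾ basis j) t)                     ≈⟨ eval-sum (λ j → const (r j) *ᴾ basis j) t ⟨
        eval (sumᴾ (λ j → const (r j) *ᴾ basis j)) t                    ≈⟨ eval-≃ {sumᴾ (λ j → const (r j) *ᴾ basis j)} {0ᴾ} t v (mk~ d) ⟩
        0#                                                              ∎
        where
        open SetoidReasoning setoid
        t = zero-point k
        v : VanishesAt I t
        v = S.sound k

    radical : Radical I
    radical f k f^k∈ = ~0⇒∈ ideal (begin
      f                                                        ≈⟨ interpolate f ⟩
      sumᴾ (λ j → const (eval f (zero-point j)) *ᴾ basis j)    ≈⟨ Q.sum-cong-≋ {zeroCount} (λ j →
                                                                    Q.trans (Q.*-congʳ {basis j} (≈ᴾ⇒~ ideal (≈ᴾ-trans (const-cong (value j)) const-0)))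
                                                                            (Q.zeroˡ (basis j))) ⟩
      sumᴾ {n} {zeroCount} (λ j → 0ᴾ)                          ≈⟨ Q.sum-replicate-zero zeroCount ⟩
      0ᴾ                                                       ∎)
      where
      open SetoidReasoning Q.setoid
      value : ∀ j → eval f (zero-point j) ≈ 0#
      -- The exponent 0 is included: then 1 lies in I, and its vanishing at a zero contradicts
      -- `1≉0`.
      value j with eval f (zero-point j) ≈? 0#
      ... | yes ≈0 = ≈0
      ... | no ≉0  = contradiction
        (trans (sym (eval-^ f k (zero-point j))) (S.sound j _ f^k∈)) (^-≉0 k ≉0)

    𝒵-cardinality : HasCardinality (𝒵 I) zeroCount
    𝒵-cardinality = record
      { to = λ j → zero-point j , S.sound j
      ; cong = λ { ≡.refl k → refl }
      ; bijective = (λ eq → S.distinct (point-injective eq)) , λ (s , v) →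
          let p , s≈p = point-onto s
              j , eq  = S.complete {p} λ f f∈ → trans (sym (eval-congʳ f s≈p)) (v f f∈)
          in j , λ { ≡.refl k → trans (reflexive (≡.cong (λ p → point p k) eq)) (sym (s≈p k)) }
      }

-- Polynomials in one and two variables as arrays of coefficients

module PermutationPolynomials {c ℓ} (R : CommutativeRing c ℓ) (m : ℕ) (1<m : 1 < m)
  (cardinality : HasCardinality (CommutativeRing.setoid R) (suc m))
  (invertible : HasInverses R) where
  open CommutativeRing R hiding (zero)
  open SemiringOps (RawRing.rawSemiring rawRing) using (_^_; sum)
  open SemiringSum semiring using (sum-cong-≋; ∑-distrib-+; *-distribˡ-sum; *-distribʳ-sum; ∑-comm)
  open Exponentiation commutativeSemiring using (^-congˡ)
  open GroupProperties +-group using (x∙y⁻¹≈ε⇒x≈y; x≈y⇒x∙y⁻¹≈ε; ∙-cancelʳ; //-rightDividesˡ)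
  open Polynomials R
  open Ideals R
  open LinearAlgebra R
  open PermutationIdeals R (suc m)
  open PolynomialRing R
  open QuotientRing R
  open FiniteField R m 1<m cardinality invertible
  open Nullstellensatz R m 1<m cardinality invertible

  coeff-sum : ∀ {n k} (f : Vector (Poly n) k) μ → coeff (sumᴾ f) μ ≈ sum λ i → coeff (f i) μ
  coeff-sum {k = zero}  f μ = refl
  coeff-sum {k = suc k} f μ = trans (coeff-+ (f zero) _ μ) (+-congˡ (coeff-sum (f ∘ suc) μ))

  coeff-term-≡ : ∀ {n} r (μ : Monomial n) → coeff (term r μ) μ ≈ r
  coeff-term-≡ r μ with Vec.≡-dec ℕ._≟_ μ μ
  ... | yes _  = +-identityʳ r
  ... | no μ≢μ = contradiction ≡.refl μ≢μ

  coeff-term-≢ : ∀ {n} r {μ ν : Monomial n} → ν ≢ μ → coeff (term r ν) μ ≈ 0#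
  coeff-term-≢ r {μ} {ν} ν≢μ with Vec.≡-dec ℕ._≟_ ν μ
  ... | yes ν≡μ = contradiction ν≡μ ν≢μ
  ... | no _    = +-identityʳ 0#

  term-cong : ∀ {n r s} {μ ν : Monomial n} → r ≈ s → μ ≡ ν → term r μ ≈ᴾ term s ν
  term-cong r≈s ≡.refl = ≈ᴾ-by-pairing λ φ → +-congʳ (*-congʳ r≈s)

  const-*-term : ∀ {n} r (μ : Monomial n) → const r *ᴾ term 1# μ ≈ᴾ term r μ
  const-*-term r μ = term-cong (*-identityʳ r) (+ᵐ-identityˡ μ)

  term-*-term : ∀ {n} (μ ν : Monomial n) {κ} → μ +ᵐ ν ≡ κ → term 1# μ *ᴾ term 1# ν ≈ᴾ term 1# κ
  term-*-term μ ν eq = term-cong (*-identityʳ 1#) eq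

  var-power₁ : ∀ e → var zero ^ᴾ e ≈ᴾ term 1# (e ∷ [])
  var-power₁ zero    = ≈ᴾ-refl
  var-power₁ (suc e) = ≈ᴾ-trans (*ᴾ-congˡ {x = var zero} (var-power₁ e))
    (term-*-term (1 ∷ []) (e ∷ []) ≡.refl)

  var-powerˣ : ∀ e → var zero ^ᴾ e ≈ᴾ term 1# (e ∷ 0 ∷ [])
  var-powerˣ zero    = ≈ᴾ-refl
  var-powerˣ (suc e) = ≈ᴾ-trans (*ᴾ-congˡ {x = var zero} (var-powerˣ e))
    (term-*-term (1 ∷ 0 ∷ []) (e ∷ 0 ∷ []) ≡.refl)

  var-powerʸ : ∀ e → var (suc zero) ^ᴾ e ≈ᴾ term 1# (0 ∷ e ∷ [])
  var-powerʸ zero    = ≈ᴾ-refl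
  var-powerʸ (suc e) = ≈ᴾ-trans (*ᴾ-congˡ {x = var (suc zero)} (var-powerʸ e))
    (term-*-term (0 ∷ 1 ∷ []) (0 ∷ e ∷ []) ≡.refl)

  -- `toPoly₁` with the number of coefficients left free: a polynomial of degree below q is expanded
  -- with `suc m` of them, and with `m` once the top one is known to vanish.
  univariate : ∀ {d} → Vector Carrier d → Poly 1
  univariate r = sumᴾ λ k → const (r k) *ᴾ var zero ^ᴾ toℕ k

  bivariate : ∀ {d} → (Fin d → Fin d → Carrier) → Poly 2
  bivariate r = sumᴾ λ k → sumᴾ λ l →
    const (r k l) *ᴾ (var zero ^ᴾ toℕ k *ᴾ var (suc zero) ^ᴾ toℕ l)

  exponent₁ : ∀ {d} → Fin d → Monomial 1
  exponent₁ k = toℕ k ∷ []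

  exponent₂ : ∀ {d} → Fin d → Fin d → Monomial 2
  exponent₂ k l = toℕ k ∷ toℕ l ∷ []

  exponent₁-injective : ∀ {d} {i k : Fin d} → exponent₁ i ≡ exponent₁ k → i ≡ k
  exponent₁-injective eq = Fin.toℕ-injective (≡.cong Vec.head eq)

  exponent₂-injective : ∀ {d} {i j k l : Fin d} → exponent₂ i j ≡ exponent₂ k l → i ≡ k × j ≡ l
  exponent₂-injective eq = Fin.toℕ-injective (≡.cong Vec.head eq)
                         , Fin.toℕ-injective (≡.cong (Vec.head ∘ Vec.tail) eq)

  coeff-univariate : ∀ {d} (r : Vector Carrier d) μ →
    coeff (univariate r) μ ≈ sum λ k → coeff (term (r k) (exponent₁ k)) μ
  coeff-univariate {d} r μ = trans (coeff-sum (λ k → const (r k) *ᴾ var zero ^ᴾ toℕ k) μ)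
    (sum-cong-≋ {d} λ k → _≈ᴾ_.coeff-≈ (≈ᴾ-trans (*ᴾ-congˡ {x = const (r k)} (var-power₁ (toℕ k)))
                                           (const-*-term (r k) (exponent₁ k))) μ)

  coeff-univariate-outside : ∀ {d} (r : Vector Carrier d) μ → (∀ k → exponent₁ {d} k ≢ μ) →
    coeff (univariate r) μ ≈ 0#
  coeff-univariate-outside r μ outside =
    trans (coeff-univariate r μ) (sum-zero _ λ k → coeff-term-≢ (r k) (outside k))

  coeff-univariate-at : ∀ {d} (r : Vector Carrier d) k → coeff (univariate r) (exponent₁ k) ≈ r k
  coeff-univariate-at r k = trans (coeff-univariate r (exponent₁ k))
    (trans (sum-single _ k λ i i≢k → coeff-term-≢ (r i) {exponent₁ k} {exponent₁ i} (i≢k ∘ exponent₁-injective))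
           (coeff-term-≡ (r k) (exponent₁ k)))

  coeff-bivariate : ∀ {d} (r : Fin d → Fin d → Carrier) μ →
    coeff (bivariate r) μ ≈ sum λ k → sum λ l → coeff (term (r k l) (exponent₂ k l)) μ
  coeff-bivariate {d} r μ = trans (coeff-sum (λ k → sumᴾ (monomial k)) μ)
    (sum-cong-≋ {d} λ k → trans (coeff-sum (monomial k) μ)
      (sum-cong-≋ {d} λ l → _≈ᴾ_.coeff-≈ (simplify k l) μ))
    where
    monomial : Fin d → Fin d → Poly 2
    monomial k l = const (r k l) *ᴾ (var zero ^ᴾ toℕ k *ᴾ var (suc zero) ^ᴾ toℕ l)
    simplify : ∀ k l → monomial k l ≈ᴾ term (r k l) (exponent₂ k l)
    simplify k l = ≈ᴾ-trans
      (*ᴾ-congˡ {x = const (r k l)} (≈ᴾ-trans (*ᴾ-cong (var-powerˣ (toℕ k)) (var-powerʸ (toℕ l)))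
        (term-*-term (toℕ k ∷ 0 ∷ []) (0 ∷ toℕ l ∷ []) (≡.cong (_∷ toℕ l ∷ []) (ℕ.+-identityʳ (toℕ k))))))
      (const-*-term (r k l) (exponent₂ k l))

  coeff-bivariate-outside : ∀ {d} (r : Fin d → Fin d → Carrier) μ →
    (∀ k l → exponent₂ {d} k l ≢ μ) → coeff (bivariate r) μ ≈ 0#
  coeff-bivariate-outside r μ outside = trans (coeff-bivariate r μ)
    (sum-zero _ λ k → sum-zero _ λ l → coeff-term-≢ (r k l) (outside k l))

  coeff-bivariate-at : ∀ {d} (r : Fin d → Fin d → Carrier) k l →
    coeff (bivariate r) (exponent₂ k l) ≈ r k l
  coeff-bivariate-at r k l = trans (coeff-bivariate r (exponent₂ k l))
    (trans (sum-single _ k λ i i≢k → sum-zero _ λ j →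
              coeff-term-≢ (r i j) {exponent₂ k l} {exponent₂ i j} (i≢k ∘ proj₁ ∘ exponent₂-injective))
    (trans (sum-single _ l λ j j≢l →
              coeff-term-≢ (r k j) {exponent₂ k l} {exponent₂ k j} (j≢l ∘ proj₂ ∘ exponent₂-injective))
           (coeff-term-≡ (r k l) (exponent₂ k l))))

  -- `DegreesBelow` speaks of coefficients that are not zero; decidable equality turns it into the
  -- vanishing of the others.
  high-coefficient≈0 : ∀ {n d} {f : Poly n} → DegreesBelow d f → ∀ μ k → ¬ (lookup μ k < d) → coeff f μ ≈ 0#
  high-coefficient≈0 {f = f} deg μ k high with coeff f μ ≈? 0#
  ... | yes ≈0 = ≈0
  ... | no ≉0  = contradiction (deg μ ≉0 k) high

  univariate-degrees : ∀ {d} (r : Vector Carrier d) → DegreesBelow d (univariate r)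
  univariate-degrees {d} r (e ∷ []) ≉0 zero with e ℕ.<? d
  ... | yes e<d = e<d
  ... | no e≮d  = contradiction (coeff-univariate-outside r (e ∷ []) λ where
    k ≡.refl → e≮d (Fin.toℕ<n k)) ≉0

  bivariate-degrees : ∀ {d} (r : Fin d → Fin d → Carrier) → DegreesBelow d (bivariate r)
  bivariate-degrees {d} r μ ≉0 i with lookup μ i ℕ.<? d
  ... | yes <d = <d
  ... | no ≮d  = contradiction (coeff-bivariate-outside r μ λ k l eq →
    ≮d (≡.subst (λ μ → lookup μ i < d) eq (bound k l i))) ≉0
    where
    bound : ∀ (k l : Fin d) i → lookup (exponent₂ k l) i < d
    bound k l zero       = Fin.toℕ<n k
    bound k l (suc zero) = Fin.toℕ<n l

  expand₁ : ∀ {d} (f : Poly 1) → DegreesBelow d f → univariate {d} (λ k → coeff f (exponent₁ k)) ≈ᴾ f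
  expand₁ {d} f deg = mk≈ᴾ agree
    where
    r : Vector Carrier d
    r k = coeff f (exponent₁ k)
    agree : ∀ μ → coeff (univariate r) μ ≈ coeff f μ
    agree μ@(e ∷ []) with e ℕ.<? d
    ... | no e≮d  = trans
      (coeff-univariate-outside r μ λ where k ≡.refl → e≮d (Fin.toℕ<n k))
      (sym (high-coefficient≈0 {f = f} deg μ zero e≮d))
    ... | yes e<d = ≡.subst (λ e → coeff (univariate r) (e ∷ []) ≈ coeff f (e ∷ []))
      (Fin.toℕ-fromℕ< e<d) (coeff-univariate-at r (fromℕ< e<d))

  expand₂ : ∀ {d} (f : Poly 2) → DegreesBelow d f → bivariate {d} (λ k l → coeff f (exponent₂ k l)) ≈ᴾ f
  expand₂ {d} f deg = mk≈ᴾ agree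
    where
    r : Fin d → Fin d → Carrier
    r k l = coeff f (exponent₂ k l)
    agree : ∀ μ → coeff (bivariate r) μ ≈ coeff f μ
    agree μ@(e ∷ e′ ∷ []) with e ℕ.<? d | e′ ℕ.<? d
    ... | no e≮d | _ = trans
      (coeff-bivariate-outside r μ λ where k l ≡.refl → e≮d (Fin.toℕ<n k))
      (sym (high-coefficient≈0 {f = f} deg μ zero e≮d))
    ... | yes _ | no e′≮d = trans
      (coeff-bivariate-outside r μ λ where k l ≡.refl → e′≮d (Fin.toℕ<n l))
      (sym (high-coefficient≈0 {f = f} deg μ (suc zero) e′≮d))
    ... | yes e<d | yes e′<d =
      ≡.subst₂ (λ e e′ → coeff (bivariate r) (e ∷ e′ ∷ []) ≈ coeff f (e ∷ e′ ∷ []))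
        (Fin.toℕ-fromℕ< e<d) (Fin.toℕ-fromℕ< e′<d) (coeff-bivariate-at r (fromℕ< e<d) (fromℕ< e′<d))

  evalCoefficients₂ : ∀ {d} → (Fin d → Fin d → Carrier) → Carrier → Carrier → Carrier
  evalCoefficients₂ r x y = evalCoefficients (λ k → evalCoefficients (r k) y) x

  evalCoefficients-congˡ : ∀ {d} {r s : Vector Carrier d} → (∀ k → r k ≈ s k) → ∀ x →
    evalCoefficients r x ≈ evalCoefficients s x
  evalCoefficients-congˡ {d} r≈s x = sum-cong-≋ {d} λ k → *-congʳ (r≈s k)

  evalCoefficients-congʳ : ∀ {d} (r : Vector Carrier d) {x y} → x ≈ y →
    evalCoefficients r x ≈ evalCoefficients r y
  evalCoefficients-congʳ {d} r x≈y = sum-cong-≋ {d} λ k → *-congˡ {r k} (^-congˡ (toℕ k) x≈y)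

  -- Reads the array as a polynomial in y with coefficients depending on x. The maps y ↦ f(a, y) are
  -- needed in this form.
  evalCoefficients₂-swap : ∀ {d} (r : Fin d → Fin d → Carrier) x y →
    evalCoefficients₂ r x y ≈ evalCoefficients₂ (λ l k → r k l) y x
  evalCoefficients₂-swap {d} r x y = begin
    sum (λ k → sum (λ l → r k l * y ^ toℕ l) * x ^ toℕ k)
      ≈⟨ sum-cong-≋ {d} (λ k → *-distribʳ-sum (x ^ toℕ k) (λ l → r k l * y ^ toℕ l)) ⟩
    sum (λ k → sum λ l → r k l * y ^ toℕ l * x ^ toℕ k)
      ≈⟨ ∑-comm (λ k l → r k l * y ^ toℕ l * x ^ toℕ k) ⟩
    sum (λ l → sum λ k → r k l * y ^ toℕ l * x ^ toℕ k)
      ≈⟨ sum-cong-≋ {d} (λ l → sum-cong-≋ {d} λ k → xy∙z≈xz∙y (r k l) (y ^ toℕ l) (x ^ toℕ k)) ⟩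
    sum (λ l → sum λ k → r k l * x ^ toℕ k * y ^ toℕ l)
      ≈⟨ sum-cong-≋ {d} (λ l → *-distribʳ-sum (y ^ toℕ l) (λ k → r k l * x ^ toℕ k)) ⟨
    sum (λ l → sum (λ k → r k l * x ^ toℕ k) * y ^ toℕ l) ∎
    where
    open SetoidReasoning setoid
    open CommutativeSemigroupProperties *-commutativeSemigroup using (xy∙z≈xz∙y)

  eval-univariate : ∀ {d} (r : Vector Carrier d) x → eval₁ (univariate r) x ≈ evalCoefficients r x
  eval-univariate {d} r x = trans (eval-sum (λ k → const (r k) *ᴾ var zero ^ᴾ toℕ k) s)
    (sum-cong-≋ {d} λ k → trans (eval-* (const (r k)) (var zero ^ᴾ toℕ k) s)
      (*-cong (eval-const (r k) s) (trans (eval-^ (var zero) (toℕ k) s) (^-congˡ (toℕ k) (eval-var zero s)))))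
    where
    s : Vector Carrier 1
    s = x Vector.∷ Vector.[]

  eval-bivariate : ∀ {d} (r : Fin d → Fin d → Carrier) x y →
    eval₂ (bivariate r) x y ≈ evalCoefficients₂ r x y
  eval-bivariate {d} r x y = begin
    eval (bivariate r) s
      ≈⟨ eval-sum (λ k → sumᴾ (monomial k)) s ⟩
    sum (λ k → eval (sumᴾ (monomial k)) s)
      ≈⟨ sum-cong-≋ {d} (λ k → trans (eval-sum (monomial k) s) (sum-cong-≋ {d} (value k))) ⟩
    sum (λ k → sum λ l → r k l * y ^ toℕ l * x ^ toℕ k)
      ≈⟨ sum-cong-≋ {d} (λ k → *-distribʳ-sum (x ^ toℕ k) (λ l → r k l * y ^ toℕ l)) ⟨
    evalCoefficients₂ r x y ∎
    where
    open SetoidReasoning setoid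
    s : Vector Carrier 2
    s = x Vector.∷ y Vector.∷ Vector.[]
    monomial : Fin d → Fin d → Poly 2
    monomial k l = const (r k l) *ᴾ (var zero ^ᴾ toℕ k *ᴾ var (suc zero) ^ᴾ toℕ l)
    value : ∀ k l → eval (monomial k l) s ≈ r k l * y ^ toℕ l * x ^ toℕ k
    value k l = begin
      eval (monomial k l) s
        ≈⟨ trans (eval-* (const (r k l)) (var zero ^ᴾ toℕ k *ᴾ var (suc zero) ^ᴾ toℕ l) s)
                 (*-cong (eval-const (r k l) s) (eval-* (var zero ^ᴾ toℕ k) (var (suc zero) ^ᴾ toℕ l) s)) ⟩
      r k l * (eval (var zero ^ᴾ toℕ k) s * eval (var (suc zero) ^ᴾ toℕ l) s)
        ≈⟨ *-congˡ (*-cong (trans (eval-^ (var zero) (toℕ k) s) (^-congˡ (toℕ k) (eval-var zero s)))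
                           (trans (eval-^ (var (suc zero)) (toℕ l) s) (^-congˡ (toℕ l) (eval-var (suc zero) s)))) ⟩
      r k l * (x ^ toℕ k * y ^ toℕ l)
        ≈⟨ trans (*-congˡ (*-comm _ _)) (sym (*-assoc _ _ _)) ⟩
      r k l * y ^ toℕ l * x ^ toℕ k ∎

  -- Injectivity of polynomial maps and the linear forms in the generators

  Injective : (Carrier → Carrier) → Set (c ⊔ ℓ)
  Injective φ = ∀ {x y} → φ x ≈ φ y → x ≈ y

  Collision : (Carrier → Carrier) → Set (c ⊔ ℓ)
  Collision φ = ∃ λ a → ∃ λ b → ¬ (a ≈ b) × φ a ≈ φ b

  -- A search through the finite field. A collision found is explicit enough to name a generator
  -- that does not vanish; the parameter of `φ` is the variable held fixed in the two-variable case.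
  injective-or-collision : (φ : Carrier → Carrier → Carrier) → (∀ {r s x y} → r ≈ s → x ≈ y → φ r x ≈ φ s y) →
    (∀ r → Injective (φ r)) ⊎ ∃ λ r → Collision (φ r)
  injective-or-collision φ φ-cong
    with Fin.any? (λ k → Fin.any? λ i → Fin.any? λ j →
           ¬? (element i ≈? element j) ×-dec (φ (element k) (element i) ≈? φ (element k) (element j)))
  ... | yes (k , i , j , i≉j , eq) = inj₂ (element k , element i , element j , i≉j , eq)
  ... | no none = inj₁ injective
    where
    injective : ∀ r → Injective (φ r)
    injective r {x} {y} eq with x ≈? y
    ... | yes x≈y = x≈y
    ... | no x≉y  = contradiction
      ( index r , index x , index y
      , (λ e → x≉y (trans (sym (element-index x)) (trans e (element-index y))))
      , trans (φ-cong (element-index r) (element-index x))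
              (trans eq (sym (φ-cong (element-index r) (element-index y)))))
      none

  -- On a finite field injectivity gives surjectivity. `ψ` is the form in which the values of `φ`
  -- are computed from coefficients.
  isPermutation : ∀ {φ ψ : Carrier → Carrier} → (∀ x → φ x ≈ ψ x) → (∀ {x y} → x ≈ y → ψ x ≈ ψ y) →
    Injective ψ → IsPermutation φ
  isPermutation {φ} {ψ} φ≈ψ ψ-cong ψ-inj =
      (λ {x} {y} eq → ψ-inj (trans (sym (φ≈ψ x)) (trans eq (φ≈ψ y))))
    , λ y → let x , onto = injective⇒onto ψ ψ-cong ψ-inj y in x , λ {z} z≈x → trans (φ≈ψ z) (onto z≈x)

  eval-F : ∀ {n} (f : Poly n) s → eval (F f) s ≈ eval f s ^ m - 1#
  eval-F f s = trans (eval-- (f ^ᴾ m) 1ᴾ s) (+-cong (eval-^ f m s) (-‿cong (eval-const 1# s)))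

  F-vanishes : ∀ {n} (f : Poly n) s → ¬ (eval f s ≈ 0#) → eval (F f) s ≈ 0#
  F-vanishes f s ≉0 = trans (eval-F f s) (x≈y⇒x∙y⁻¹≈ε (x^m≈1 _ ≉0))

  F-vanishes⇒≉0 : ∀ {n} (f : Poly n) s → eval (F f) s ≈ 0# → ¬ (eval f s ≈ 0#)
  F-vanishes⇒≉0 f s F≈0 f≈0 = 1≉0 (trans
    (sym (x∙y⁻¹≈ε⇒x≈y _ _ (trans (sym (eval-F f s)) F≈0)))
    (trans (^-congˡ m f≈0) 0^m≈0))

  sum-powerDiff : ∀ (r : Vector Carrier m) a b →
    sum (λ k → powerDiff a b k * r k) ≈ evalCoefficients r a - evalCoefficients r b
  sum-powerDiff r a b = ∙-cancelʳ (evalCoefficients r b) _ _ (begin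
    sum (λ k → powerDiff a b k * r k) + evalCoefficients r b
      ≈⟨ ∑-distrib-+ (λ k → powerDiff a b k * r k) (λ k → r k * b ^ toℕ k) ⟨
    sum (λ k → powerDiff a b k * r k + r k * b ^ toℕ k)
      ≈⟨ sum-cong-≋ {m} (λ k → trans (+-congʳ (*-comm (powerDiff a b k) (r k)))
           (trans (sym (distribˡ (r k) (powerDiff a b k) (b ^ toℕ k))) (*-congˡ (//-rightDividesˡ (b ^ toℕ k) (a ^ toℕ k))))) ⟩
    evalCoefficients r a
      ≈⟨ //-rightDividesˡ (evalCoefficients r b) (evalCoefficients r a) ⟨
    evalCoefficients r a - evalCoefficients r b + evalCoefficients r b ∎)
    where open SetoidReasoning setoid

  linearForm : DistinctPair → Poly m
  linearForm (a , b , _) = sumᴾ λ k → const (powerDiff a b k) *ᴾ var k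

  eval-linearForm : ∀ (((a , b , a≉b)) : DistinctPair) s →
    eval (linearForm (a , b , a≉b)) s ≈ evalCoefficients s a - evalCoefficients s b
  eval-linearForm (a , b , _) s = trans (eval-sum (λ k → const (powerDiff a b k) *ᴾ var k) s)
    (trans (sum-cong-≋ {m} λ k → trans (eval-* (const (powerDiff a b k)) (var k) s)
              (*-cong (eval-const (powerDiff a b k) s) (eval-var k s)))
           (sum-powerDiff s a b))

  -- Covers both the row and the column forms, according to the double index ι.
  planeForm : (Index → Index → Index²) → DistinctPair × Carrier → Poly (m ℕ.* m)
  planeForm ι ((a , b , _) , r) = sumᴾ λ k → sumᴾ λ l →
    const (powerDiff a b k * r ^ toℕ l) *ᴾ var (ι k l)

  -- Substituting r for the variable with exponent l leaves a polynomial in one variable with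
  -- coefficients `t`: it is f(x, r) when `ι` is `_▸_`, and f(r, y) when `ι` is `rowIndex`.
  eval-planeForm : ∀ (ι : Index → Index → Index²) (((a , b , a≉b) , r) : DistinctPair × Carrier) s →
    let t = λ k → evalCoefficients (λ l → s (ι k l)) r in
    eval (planeForm ι ((a , b , a≉b) , r)) s ≈ evalCoefficients t a - evalCoefficients t b
  eval-planeForm ι ((a , b , _) , r) s = begin
    eval (sumᴾ λ k → sumᴾ (summand k)) s
      ≈⟨ eval-sum (λ k → sumᴾ (summand k)) s ⟩
    sum (λ k → eval (sumᴾ (summand k)) s)
      ≈⟨ sum-cong-≋ {m} (λ k → trans (eval-sum (summand k) s) (sum-cong-≋ {m} (value k))) ⟩
    sum (λ k → sum λ l → powerDiff a b k * (s (ι k l) * r ^ toℕ l))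
      ≈⟨ sum-cong-≋ {m} (λ k → *-distribˡ-sum (powerDiff a b k) (λ l → s (ι k l) * r ^ toℕ l)) ⟨
    sum (λ k → powerDiff a b k * evalCoefficients (λ l → s (ι k l)) r)
      ≈⟨ sum-powerDiff (λ k → evalCoefficients (λ l → s (ι k l)) r) a b ⟩
    _ ∎
    where
    open SetoidReasoning setoid
    summand : Index → Index → Poly (m ℕ.* m)
    summand k l = const (powerDiff a b k * r ^ toℕ l) *ᴾ var (ι k l)
    value : ∀ k l → eval (summand k l) s ≈ powerDiff a b k * (s (ι k l) * r ^ toℕ l)
    value k l = begin
      eval (summand k l) s                          ≈⟨ eval-* (const (powerDiff a b k * r ^ toℕ l)) (var (ι k l)) s ⟩
      _ * _                                         ≈⟨ *-cong (eval-const _ s) (eval-var (ι k l) s) ⟩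
      powerDiff a b k * r ^ toℕ l * s (ι k l)       ≈⟨ *-assoc _ _ _ ⟩
      powerDiff a b k * (r ^ toℕ l * s (ι k l))     ≈⟨ *-congˡ (*-comm _ _) ⟩
      powerDiff a b k * (s (ι k l) * r ^ toℕ l)     ∎

  -- Treats both ideals at once. `κ` lists the variables in the field equations, as the identity for
  -- `𝓘` and as the flattened double index for `𝓙`.
  module FieldEquations {a b n} {A : Set a} {B : Set b} (g : A → Poly n) (κ : B → Fin n)
    (κ-onto : ∀ k → ∃ λ x → κ x ≡ k)
    (decide : ∀ s → (∀ x → eval (g x) s ≈ 0#) ⊎ ∃ λ x → ¬ (eval (g x) s ≈ 0#)) where

    I : Pred (Poly n) _
    I = ⟨ g ⟩ +ᴵ ⟨ (λ x → fieldEquation (κ x)) ⟩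

    private
      ⟨⟩-vanishes : ∀ {d} {D : Set d} {h : D → Poly n} {s} → (∀ x → eval (h x) s ≈ 0#) → VanishesAt ⟨ h ⟩ s
      ⟨⟩-vanishes {s = s} h≈0 _ (generator x)        = h≈0 x
      ⟨⟩-vanishes {s = s} h≈0 _ zero∈                = refl
      ⟨⟩-vanishes {s = s} h≈0 _ (+-closed {f} {f′} f∈ f′∈) = trans (eval-+ f f′ s)
        (trans (+-cong (⟨⟩-vanishes h≈0 f f∈) (⟨⟩-vanishes h≈0 f′ f′∈)) (+-identityʳ 0#))
      ⟨⟩-vanishes {s = s} h≈0 _ (*-closed f {f′} f′∈) = trans (eval-* f f′ s)
        (trans (*-congˡ (⟨⟩-vanishes h≈0 f′ f′∈)) (zeroʳ _))
      ⟨⟩-vanishes {s = s} h≈0 _ (≈-closed {f} f≈f′ f∈) =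
        trans (eval-cong s (≈ᴾ-sym f≈f′)) (⟨⟩-vanishes h≈0 f f∈)

      fieldEquation-vanishes : ∀ k s → eval (fieldEquation {n} k) s ≈ 0#
      fieldEquation-vanishes k s = trans (eval-- (var k ^ᴾ suc m) (var k) s) (x≈y⇒x∙y⁻¹≈ε
        (trans (eval-^ (var k) (suc m) s) (x^1+m≈x _)))

    isIdeal : IsIdeal I
    isIdeal = +ᴵ-isIdeal (⟨⟩-isIdeal g) (⟨⟩-isIdeal (λ x → fieldEquation (κ x)))

    fieldEquation∈ : ∀ k → fieldEquation k ∈ I
    fieldEquation∈ k = let x , eq = κ-onto k in
      ≡.subst (λ k → fieldEquation k ∈ I) eq
        (+ᴵ-right {I = ⟨ g ⟩} {J = ⟨ (λ x → fieldEquation (κ x)) ⟩} (⟨⟩-isIdeal g) (generator x))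

    generator∈ : ∀ x → g x ∈ I
    generator∈ x = +ᴵ-left {I = ⟨ g ⟩} {J = ⟨ (λ x → fieldEquation (κ x)) ⟩}
      (⟨⟩-isIdeal (λ x → fieldEquation (κ x))) (generator x)

    vanishes : ∀ {s} → (∀ x → eval (g x) s ≈ 0#) → VanishesAt I s
    vanishes {s} g≈0 f (f₁ , f₂ , f₁∈ , f₂∈ , f≈) = trans (eval-cong s f≈) (trans (eval-+ f₁ f₂ s)
      (trans (+-cong (⟨⟩-vanishes g≈0 f₁ f₁∈) (⟨⟩-vanishes (λ x → fieldEquation-vanishes (κ x) s) f₂ f₂∈))
             (+-identityʳ 0#)))

    -- Testing the generators `g` suffices: the field equations vanish at every point, vanishing
    -- spreads to the whole ideal, and a generator with nonzero value is itself the separating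
    -- element.
    classify : ∀ s → VanishesAt I s ⊎ SeparatedFrom I s
    classify s with decide s
    ... | inj₁ g≈0       = inj₁ (vanishes g≈0)
    ... | inj₂ (x , g≉0) = inj₂ (g x , generator∈ x , g≉0)

    -- The equality of the three numbers is expressed by a single N; the count of zeros is carried
    -- to the polynomials along β.
    conclusion : ∀ {p p′} {P : Setoid p p′} {C : Bijection (𝒵 I) P → Set (c ⊔ ℓ)} → ∃ C →
      ZeroDimensional I × Radical I × ∃ C ×
      (∃ λ N → HasCardinality P N × HasCardinality (𝒵 I) N × HasDimension (Quotient I) N)
    conclusion (β , Cβ) = (N , dim) , radical isIdeal fieldEquation∈ classify , (β , Cβ) ,
      N , Composition.bijection card𝒵 β , card𝒵 , dim
      where
      N = zeroCount isIdeal fieldEquation∈ classify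
      dim = hasDimension isIdeal fieldEquation∈ classify
      card𝒵 = 𝒵-cardinality isIdeal fieldEquation∈ classify

  bijective-injective : ∀ {φ ψ : Carrier → Carrier} → (∀ x → φ x ≈ ψ x) → IsPermutation φ → Injective ψ
  bijective-injective φ≈ψ (φ-inj , _) {x} {y} eq = φ-inj (trans (φ≈ψ x) (trans eq (sym (φ≈ψ y))))

  -- eval f s ≈ φ a - φ b for one of the linear forms f, so F f vanishes at s iff φ separates a and b.
  module _ {n} (f : DistinctPair → Poly n) {s : Vector Carrier n} {φ : Carrier → Carrier}
    (eval-f : ∀ (((a , b , a≉b)) : DistinctPair) → eval (f (a , b , a≉b)) s ≈ φ a - φ b) where

    injective⇒F-vanishes : Injective φ → ∀ x → eval (F (f x)) s ≈ 0#
    injective⇒F-vanishes φ-inj x@(a , b , a≉b) = F-vanishes (f x) s λ ≈0 →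
      a≉b (φ-inj (x∙y⁻¹≈ε⇒x≈y _ _ (trans (sym (eval-f x)) ≈0)))

    collision⇒F-nonzero : Collision φ → ∃ λ x → ¬ (eval (F (f x)) s ≈ 0#)
    collision⇒F-nonzero (a , b , a≉b , eq) = x , λ F≈0 →
      F-vanishes⇒≉0 (f x) s F≈0 (trans (eval-f x) (x≈y⇒x∙y⁻¹≈ε eq))
      where
      x : DistinctPair
      x = a , b , a≉b

    F-vanishes⇒injective : (∀ x → eval (F (f x)) s ≈ 0#) → Injective φ
    F-vanishes⇒injective F≈0 {a} {b} eq with a ≈? b
    ... | yes a≈b = a≈b
    ... | no a≉b  = contradiction (trans (eval-f (a , b , a≉b)) (x≈y⇒x∙y⁻¹≈ε eq))
      (F-vanishes⇒≉0 (f (a , b , a≉b)) s (F≈0 (a , b , a≉b)))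

  -- Permutation polynomials

  decide₁ : ∀ s → (∀ x → eval F[ x ] s ≈ 0#) ⊎ ∃ λ x → ¬ (eval F[ x ] s ≈ 0#)
  decide₁ s with injective-or-collision (λ _ → evalCoefficients s) (λ _ → evalCoefficients-congʳ s)
  -- The family of maps is constant in its parameter, so 0 is an arbitrary value for it.
  ... | inj₁ inj       = inj₁ (injective⇒F-vanishes linearForm (λ x → eval-linearForm x s) (inj 0#))
  ... | inj₂ (_ , col) = inj₂ (collision⇒F-nonzero linearForm (λ x → eval-linearForm x s) col)

  module 𝓘-ideal = FieldEquations F[_] id (λ k → k , ≡.refl) decide₁

  univariate-cong : ∀ {d} {r s : Vector Carrier d} → (∀ k → r k ≈ s k) → univariate r ≈ᴾ univariate s
  univariate-cong {d} r≈s = SemiringSum.sum-cong-≋ (CommutativeRing.semiring (polyRing 1)) {d} λ k →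
    *ᴾ-congʳ {x = var zero ^ᴾ toℕ k} (const-cong (r≈s k))

  univariate-injective : ∀ {d} {r s : Vector Carrier d} → univariate r ≈ᴾ univariate s → ∀ k → r k ≈ s k
  univariate-injective {r = r} {s} (mk≈ᴾ eq) k = trans (sym (coeff-univariate-at r k))
    (trans (eq (exponent₁ k)) (coeff-univariate-at s k))

  eval-expand₁ : ∀ {d} (f : Poly 1) → DegreesBelow d f → ∀ x →
    eval₁ f x ≈ evalCoefficients {d} (λ k → coeff f (exponent₁ k)) x
  eval-expand₁ {d} f deg x = trans (eval-cong _ (≈ᴾ-sym (expand₁ {d} f deg))) (eval-univariate {d} _ x)

  permutation-degree : ∀ f → IsPermutationPolynomial f → DegreesBelow m f
  permutation-degree f (deg , perm) (e ∷ []) ≉0 zero =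
    ℕ.≤∧≢⇒< (ℕ.s≤s⁻¹ (deg (e ∷ []) ≉0 zero)) λ e≡m → ≉0
      (≡.subst (λ e → coeff f (e ∷ []) ≈ 0#) (≡.trans (Fin.toℕ-fromℕ m) (≡.sym e≡m))
        (permutation⇒top-coefficient≈0 r (bijective-injective (eval-expand₁ f deg) perm)))
    where
    r : Vector Carrier (suc m)
    r k = coeff f (exponent₁ k)

  -- Surjectivity is where the degree bound of permutation polynomials is needed: a point records
  -- only the coefficients up to exponent q - 2.
  𝓘-bijection : ∃ λ (β : Bijection (𝒵 𝓘) 𝒫) → ∀ s → proj₁ (Bijection.to β s) ≈ᴾ toPoly₁ (proj₁ s)
  𝓘-bijection = record
    { to = λ (s , v) → toPoly₁ s
        , (λ μ ≉0 k → ℕ.m<n⇒m<1+n (univariate-degrees s μ ≉0 k))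
        , isPermutation (eval-univariate s) (evalCoefficients-congʳ s)
            (F-vanishes⇒injective linearForm (λ x → eval-linearForm x s) λ x → v F[ x ] (𝓘-ideal.generator∈ x))
    ; cong = univariate-cong
    ; bijective = univariate-injective , onto
    } , λ _ → ≈ᴾ-refl
    where
    onto : ∀ f → ∃ λ s → ∀ {t} → (∀ k → proj₁ t k ≈ proj₁ s k) → toPoly₁ (proj₁ t) ≈ᴾ proj₁ f
    onto (f , pp@(deg , perm)) = (s , v) , λ t≈s → ≈ᴾ-trans (univariate-cong t≈s) (expand₁ f deg′)
      where
      deg′ = permutation-degree f pp
      s : Vector Carrier m
      s k = coeff f (exponent₁ k)
      v : VanishesAt 𝓘 s
      v = 𝓘-ideal.vanishes (injective⇒F-vanishes linearForm (λ x → eval-linearForm x s)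
        (bijective-injective (eval-expand₁ f deg′) perm))

  -- Local permutation polynomials

  -- The fixed variable comes first, which makes this a family of maps in the sense of
  -- `injective-or-collision`.
  planeValue : (Index → Index → Index²) → Vector Carrier (m ℕ.* m) → Carrier → Carrier → Carrier
  planeValue ι s r x = evalCoefficients₂ (λ k l → s (ι k l)) x r

  planeValue-cong : ∀ ι s {r t x y} → r ≈ t → x ≈ y → planeValue ι s r x ≈ planeValue ι s t y
  planeValue-cong ι s {r} {y = y} r≈t x≈y = trans
    (evalCoefficients-congʳ (λ k → evalCoefficients (λ l → s (ι k l)) r) x≈y)
    (evalCoefficients-congˡ (λ k → evalCoefficients-congʳ (λ l → s (ι k l)) r≈t) y)

  plane-vanishes : ∀ ι s → (∀ r → Injective (planeValue ι s r)) → ∀ x → eval (F (planeForm ι x)) s ≈ 0#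
  plane-vanishes ι s inj (x , r) = injective⇒F-vanishes (λ x → planeForm ι (x , r))
    (λ x → eval-planeForm ι (x , r) s) (inj r) x

  plane-injective : ∀ ι s → (∀ x → eval (F (planeForm ι x)) s ≈ 0#) → ∀ r → Injective (planeValue ι s r)
  plane-injective ι s F≈0 r = F-vanishes⇒injective (λ x → planeForm ι (x , r))
    (λ x → eval-planeForm ι (x , r) s) (λ x → F≈0 (x , r))

  plane-decide : ∀ ι s → (∀ x → eval (F (planeForm ι x)) s ≈ 0#) ⊎ ∃ λ x → ¬ (eval (F (planeForm ι x)) s ≈ 0#)
  plane-decide ι s with injective-or-collision (planeValue ι s) (planeValue-cong ι s)
  ... | inj₁ inj       = inj₁ (plane-vanishes ι s inj)
  ... | inj₂ (r , col) =
    let x , ≉0 = collision⇒F-nonzero (λ x → planeForm ι (x , r)) (λ x → eval-planeForm ι (x , r) s) col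
    in inj₂ ((x , r) , ≉0)

  rowIndex : Index → Index → Index²
  rowIndex k l = l ▸ k

  decide₂ : ∀ s → (∀ x → eval ([ Gʳᵒʷ , Gᶜᵒˡ ]′ x) s ≈ 0#) ⊎ ∃ λ x → ¬ (eval ([ Gʳᵒʷ , Gᶜᵒˡ ]′ x) s ≈ 0#)
  decide₂ s with plane-decide rowIndex s | plane-decide _▸_ s
  ... | inj₁ row≈0       | inj₁ col≈0       = inj₁ λ { (inj₁ x) → row≈0 x ; (inj₂ x) → col≈0 x }
  ... | inj₂ (x , row≉0) | _                = inj₂ (inj₁ x , row≉0)
  ... | inj₁ _           | inj₂ (x , col≉0) = inj₂ (inj₂ x , col≉0)

  ▸-onto : ∀ (p : Index²) → ∃ λ ((k , l) : Index × Index) → k ▸ l ≡ p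
  ▸-onto p = Fin.remQuot m p , Fin.combine-remQuot {m} m p

  module 𝓙-ideal = FieldEquations [ Gʳᵒʷ , Gᶜᵒˡ ]′ (λ ((k , l) : Index × Index) → k ▸ l) ▸-onto decide₂

  bivariate-cong : ∀ {d} {r s : Fin d → Fin d → Carrier} → (∀ k l → r k l ≈ s k l) → bivariate r ≈ᴾ bivariate s
  bivariate-cong {d} r≈s = P.sum-cong-≋ {d} λ k → P.sum-cong-≋ {d} λ l →
    *ᴾ-congʳ {x = var zero ^ᴾ toℕ k *ᴾ var (suc zero) ^ᴾ toℕ l} (const-cong (r≈s k l))
    where module P = SemiringSum (CommutativeRing.semiring (polyRing 2))

  bivariate-injective : ∀ {d} {r s : Fin d → Fin d → Carrier} → bivariate r ≈ᴾ bivariate s →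
    ∀ k l → r k l ≈ s k l
  bivariate-injective {r = r} {s} (mk≈ᴾ eq) k l = trans (sym (coeff-bivariate-at r k l))
    (trans (eq (exponent₂ k l)) (coeff-bivariate-at s k l))

  eval-expand₂ : ∀ {d} (f : Poly 2) → DegreesBelow d f → ∀ x y →
    eval₂ f x y ≈ evalCoefficients₂ {d} (λ k l → coeff f (exponent₂ k l)) x y
  eval-expand₂ {d} f deg x y = trans (eval-cong _ (≈ᴾ-sym (expand₂ {d} f deg))) (eval-bivariate {d} _ x y)

  -- The top coefficient in x is a polynomial in y of degree < q vanishing everywhere, and vice versa.
  local-permutation-degree : ∀ f → IsLocalPermutationPolynomial f → DegreesBelow m f
  local-permutation-degree f (deg , perm) μ@(e ∷ e′ ∷ []) ≉0 i = bound i
    where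
    r : Fin (suc m) → Fin (suc m) → Carrier
    r k l = coeff f (exponent₂ k l)
    top-x : ∀ l → r (fromℕ m) l ≈ 0#
    top-x = vanishing-coefficients (r (fromℕ m)) λ a →
      permutation⇒top-coefficient≈0 (λ k → evalCoefficients (r k) a)
        (bijective-injective (λ x → eval-expand₂ f deg x a) (proj₁ (perm a)))
    top-y : ∀ k → r k (fromℕ m) ≈ 0#
    top-y = vanishing-coefficients (λ k → r k (fromℕ m)) λ a →
      permutation⇒top-coefficient≈0 (λ l → evalCoefficients (λ k → r k l) a)
        (bijective-injective (λ y → trans (eval-expand₂ f deg a y) (evalCoefficients₂-swap r a y)) (proj₂ (perm a)))
    to-m : ∀ {e} → e ≡ m → toℕ (fromℕ m) ≡ e
    to-m e≡m = ≡.trans (Fin.toℕ-fromℕ m) (≡.sym e≡m)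
    bound : ∀ i → lookup μ i < m
    bound zero       = ℕ.≤∧≢⇒< (ℕ.s≤s⁻¹ (deg μ ≉0 zero)) λ e≡m → ≉0
      (≡.subst₂ (λ e e′ → coeff f (e ∷ e′ ∷ []) ≈ 0#) (to-m e≡m) (Fin.toℕ-fromℕ< (deg μ ≉0 (suc zero)))
        (top-x (fromℕ< (deg μ ≉0 (suc zero)))))
    bound (suc zero) = ℕ.≤∧≢⇒< (ℕ.s≤s⁻¹ (deg μ ≉0 (suc zero))) λ e′≡m → ≉0
      (≡.subst₂ (λ e e′ → coeff f (e ∷ e′ ∷ []) ≈ 0#) (Fin.toℕ-fromℕ< (deg μ ≉0 zero)) (to-m e′≡m)
        (top-y (fromℕ< (deg μ ≉0 zero))))

  𝓙-bijection : ∃ λ (β : Bijection (𝒵 𝓙) ℒ𝒫) → ∀ s → proj₁ (Bijection.to β s) ≈ᴾ toPoly₂ (proj₁ s)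
  𝓙-bijection = record
    { to = λ (s , v) → toPoly₂ s
        , (λ μ ≉0 k → ℕ.m<n⇒m<1+n (bivariate-degrees (array s) μ ≉0 k))
        -- The column generators control x ↦ f(x, a). The row generators control y ↦ f(a, y), after
        -- the array is read in the other order.
        , λ a → isPermutation (λ x → eval-bivariate (array s) x a) (planeValue-cong _▸_ s refl)
                  (plane-injective _▸_ s (λ x → v (Gᶜᵒˡ x) (𝓙-ideal.generator∈ (inj₂ x))) a)
              , isPermutation (λ y → trans (eval-bivariate (array s) a y) (evalCoefficients₂-swap (array s) a y))
                  (planeValue-cong rowIndex s refl)
                  (plane-injective rowIndex s (λ x → v (Gʳᵒʷ x) (𝓙-ideal.generator∈ (inj₁ x))) a)
    ; cong = λ s≈t → bivariate-cong λ k l → s≈t (k ▸ l)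
    ; bijective = array-injective , onto
    } , λ _ → ≈ᴾ-refl
    where
    array : Vector Carrier (m ℕ.* m) → Index → Index → Carrier
    array s k l = s (k ▸ l)
    array-injective : ∀ {s t} → toPoly₂ s ≈ᴾ toPoly₂ t → ∀ p → s p ≈ t p
    array-injective {s} {t} eq p = let (k , l) , kl≡p = ▸-onto p in
      ≡.subst (λ p → s p ≈ t p) kl≡p (bivariate-injective {r = array s} {array t} eq k l)
    onto : ∀ f → ∃ λ s → ∀ {t} → (∀ k → proj₁ t k ≈ proj₁ s k) → toPoly₂ (proj₁ t) ≈ᴾ proj₁ f
    onto (f , lpp@(deg , perm)) = (s , v) , λ t≈s →
      ≈ᴾ-trans (bivariate-cong λ k l → trans (t≈s (k ▸ l)) (s-array k l)) (expand₂ f deg′)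
      where
      deg′ = local-permutation-degree f lpp
      r : Index → Index → Carrier
      r k l = coeff f (exponent₂ k l)
      s : Vector Carrier (m ℕ.* m)
      s p = let k , l = Fin.remQuot m p in r k l
      s-array : ∀ k l → s (k ▸ l) ≈ r k l
      s-array k l = reflexive (≡.cong (λ (k , l) → r k l) (Fin.remQuot-combine {m} {m} k l))
      eval-s : ∀ x y → eval₂ f x y ≈ evalCoefficients₂ (array s) x y
      eval-s x y = trans (eval-expand₂ f deg′ x y) (evalCoefficients-congˡ
        (λ k → evalCoefficients-congˡ (λ l → sym (s-array k l)) y) x)
      v : VanishesAt 𝓙 s
      v = 𝓙-ideal.vanishes λ where
        (inj₁ x) → plane-vanishes rowIndex s
          (λ a → bijective-injective (λ y → trans (eval-s a y) (evalCoefficients₂-swap (array s) a y)) (proj₂ (perm a))) x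
        (inj₂ x) → plane-vanishes _▸_ s (λ a → bijective-injective (λ x → eval-s x a) (proj₁ (perm a))) x

-- Inverses in a finite Heyting field, and the theorem

-- Inequality to 0 does not yield apartness directly, so the inverse is searched among all elements.
-- If the search fails, x cannot be apart from 0, since that would provide an inverse; tightness
-- then gives x = 0.
field-inverse : ∀ {c ℓ₁ ℓ₂ n} (𝔽 : HeytingField c ℓ₁ ℓ₂) → let open HeytingField 𝔽 in
  HasCardinality (CommutativeRing.setoid (HeytingCommutativeRing.commutativeRing heytingCommutativeRing)) n →
  ∀ x → ¬ (x ≈ 0#) → ∃ λ y → x * y ≈ 1#
field-inverse 𝔽 cardinality x x≉0 with Fin.any? (λ i → (x * element i) ≈? 1#)
  where
  open HeytingField 𝔽
  open Enumerated _ cardinality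
... | yes (i , eq) = Enumerated.element _ cardinality i , eq
... | no none = contradiction (proj₁ (tight x 0#) λ x#0 →
    let y , _ , [x-0]y≈1 = #⇒invertible x#0 in
    none (index y , trans (*-cong (sym x-0≈x) (element-index y)) [x-0]y≈1)) x≉0
  where
  open HeytingField 𝔽
  R = HeytingCommutativeRing.commutativeRing heytingCommutativeRing
  open Enumerated _ cardinality
  x-0≈x : x + - 0# ≈ x
  x-0≈x = trans (+-congˡ (RingProperties.-0#≈0# (CommutativeRing.ring R))) (+-identityʳ x)

lemma3p1 : ∀ {c ℓ₁ ℓ₂ : Level} (q : ℕ) → q > 3 → IsPrimePower q →
  (𝔽 : HeytingField c ℓ₁ ℓ₂) →
  let R = HeytingCommutativeRing.commutativeRing (HeytingField.heytingCommutativeRing 𝔽)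
      open Polynomials R
      open Ideals R
      open LinearAlgebra R
      open PermutationIdeals R q
  in
  HasCardinality (CommutativeRing.setoid R) q →
  (ZeroDimensional 𝓘 × Radical 𝓘 ×
    (∃ λ (β : Bijection (𝒵 𝓘) 𝒫) → ∀ s → proj₁ (Bijection.to β s) ≈ᴾ toPoly₁ (proj₁ s)) ×
    (∃ λ N → HasCardinality 𝒫 N × HasCardinality (𝒵 𝓘) N × HasDimension (Quotient 𝓘) N))
  ×
  (ZeroDimensional 𝓙 × Radical 𝓙 ×
    (∃ λ (β : Bijection (𝒵 𝓙) ℒ𝒫) → ∀ s → proj₁ (Bijection.to β s) ≈ᴾ toPoly₂ (proj₁ s)) ×
    (∃ λ N → HasCardinality ℒ𝒫 N × HasCardinality (𝒵 𝓙) N × HasDimension (Quotient 𝓙) N))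
lemma3p1 (suc m) (ℕ.s≤s 2<m) _ 𝔽 cardinality =
  -- With q matched as `suc m`, the expression q ∸ 1 in the definitions computes to `m`.
  𝓘-ideal.conclusion 𝓘-bijection , 𝓙-ideal.conclusion 𝓙-bijection
  where
  open PermutationPolynomials _ m (ℕ.<⇒≤ 2<m) cardinality (field-inverse 𝔽 cardinality)
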